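{- If there is an output-polynomial time (respectively, a polynomial-delay) algorithm for Minimal Capacitated Vertex Cover Enumeration on $2$-degenerate bipartite graphs, then there is an output-polynomial time (respectively, a polynomial-delay) algorithm for enumerating all minimal transversals of hypergraphs.
   Context: Graphs are finite, undirected and simple; $\mathbb N$ includes $0$. For a graph $G$ and a capacity function $c\colon V(G)\to\mathbb N$, a set $C\subseteq V(G)$ is a capacitated vertex cover of $(G,c)$ if there is a function $\alpha\colon E(G)\to C$ such that $\alpha(\{u,v\})\in\{u,v\}$ for every edge $\{u,v\}$ and $|\alpha^{ -1}(v)|\le c(v)$ for every $v\in C$; it is minimal if no proper subset is a capacitated vertex cover. Minimal Capacitated Vertex Cover Enumeration takes $(G,c)$ as input and asks to output, each exactly once, all minimal capacitated vertex covers of $(G,c)$. A graph is $k$-degenerate if it has a vertex ordering $(v_1,\dots,v_n)$ such that each $v_i$ has at most $k$ neighbors in $G[\{v_i,\dots,v_n\}]$. A transversal of a hypergraph $\mathcal H=(V,\mathcal E)$ is a set $S\subseteq V$ such that each hyperedge $e\in\mathcal E$ contains at least one vertex of $S$; minimality is with respect to inclusion. An enumeration algorithm runs in output-polynomial time if its total running time is bounded by a polynomial in the combined size of the input and all outputs; it runs in polynomial delay if the time elapsed between every two consecutive outputs (including pre-processing and post-processing) is bounded by a polynomial in the input size only. -}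

module Defs where

open import Data.Bool.Base using (Bool; true; false)
import Data.Bool.Properties as Bool
open import Data.Fin.Base using (Fin; _<_)
open import Data.Fin.Permutation using (Permutation′; _⟨$⟩ʳ_; _⟨$⟩ˡ_)
open import Data.Fin.Properties using (_≟_; _<?_; _≤?_)
open import Data.Fin.Subset using (Subset; _∈_; _⊂_; _∩_; ∣_∣; Nonempty)
open import Data.List.Base
  using (List; []; _∷_; [_]; _++_; length; map; concatMap; mapMaybe; filter; allFin; tabulate)
open import Data.List.Relation.Unary.All using (All)
open import Data.List.Relation.Unary.Unique.Propositional using (Unique)
import Data.List.Membership.Propositional as List
import Data.Maybe.Base as Maybe
open Maybe using (Maybe)
open import Data.Nat.Base using (ℕ; suc; _+_; _*_; _≤_)
open import Data.Nat.Binary.Base using (ℕᵇ; zero; 2[1+_]; 1+[2_]; fromℕ)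
open import Data.Nat.ListAction using (sum)
open import Data.Product.Base using (Σ; Σ-syntax; ∃-syntax; _×_; _,_)
open import Data.Sum.Base using (_⊎_)
import Data.Vec.Base as Vec
open import Function.Bundles using (_⇔_)
open import Relation.Binary.PropositionalEquality using (_≡_; _≢_)
open import Relation.Nullary using (¬_; does)
open import Relation.Nullary.Decidable using (_×-dec_; dec⇒maybe)

------------------------------------------------------------------------
-- Machine model

-- Programs are those of Jones's imperative language I (N. D. Jones,
-- "Computability and Complexity: From a Programming Perspective"): WHILE
-- programs over binary trees whose entire store is a single tree, held
-- in X.  An output instruction is added.

infixr 5 _∙_

data Tree : Set where
  nil : Tree
  _∙_ : Tree → Tree → Tree

size : Tree → ℕ
size nil     = 1
size (s ∙ t) = 1 + (size s + size t)

data Expr : Set where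
  X nil : Expr
  cons  : Expr → Expr → Expr
  hd tl : Expr → Expr

head tail : Tree → Tree
head nil     = nil
head (s ∙ t) = s
tail nil     = nil
tail (s ∙ t) = t

eval : Expr → Tree → Tree
eval X          x = x
eval nil        x = nil
eval (cons e f) x = eval e x ∙ eval f x
eval (hd e)     x = head (eval e x)
eval (tl e)     x = tail (eval e x)

infixr 4 _⨾_

data Program : Set where
  X:=_          : Expr → Program
  _⨾_           : Program → Program → Program
  if_then_else_ : Expr → Program → Program → Program
  while_loop_   : Expr → Program → Program
  output_       : Expr → Program

-- Every assignment, test and output takes one unit of time.  An
-- expression occurring in a program has constant size, so on trees
-- represented with sharing one unit is O(1) operations of a
-- random-access machine (printing an output takes time linear in its
-- size, which for the problems below is linear in that of the input).
-- Conversely, a random-access memory can be kept as a balanced tree, so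
-- a random-access machine running for t steps is simulated with overhead
-- polynomial in log t per step.  Hence both complexity classes below
-- agree with those of the RAM; in particular polynomial delay is
-- preserved even when exponentially much memory is used.
data Event : Set where
  tick : Event
  emit : Tree → Event

data ⟨_,_⟩⇓⟨_,_⟩ : Program → Tree → List Event → Tree → Set where
  assign   : ∀ {e x} → ⟨ X:= e , x ⟩⇓⟨ [ tick ] , eval e x ⟩
  seq      : ∀ {p q x y z s t} →
             ⟨ p , x ⟩⇓⟨ s , y ⟩ → ⟨ q , y ⟩⇓⟨ t , z ⟩ →
             ⟨ p ⨾ q , x ⟩⇓⟨ s ++ t , z ⟩
  if-true  : ∀ {e p q x y t} → eval e x ≢ nil →
             ⟨ p , x ⟩⇓⟨ t , y ⟩ → ⟨ if e then p else q , x ⟩⇓⟨ tick ∷ t , y ⟩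
  if-false : ∀ {e p q x y t} → eval e x ≡ nil →
             ⟨ q , x ⟩⇓⟨ t , y ⟩ → ⟨ if e then p else q , x ⟩⇓⟨ tick ∷ t , y ⟩
  while-true  : ∀ {e p x y z s t} → eval e x ≢ nil →
                ⟨ p , x ⟩⇓⟨ s , y ⟩ → ⟨ while e loop p , y ⟩⇓⟨ t , z ⟩ →
                ⟨ while e loop p , x ⟩⇓⟨ tick ∷ s ++ t , z ⟩
  while-false : ∀ {e p x} → eval e x ≡ nil →
                ⟨ while e loop p , x ⟩⇓⟨ [ tick ] , x ⟩
  write    : ∀ {e x} → ⟨ output e , x ⟩⇓⟨ [ emit (eval e x) ] , x ⟩

outputs : List Event → List Tree
outputs []           = []
outputs (tick   ∷ t) = outputs t
outputs (emit o ∷ t) = o ∷ outputs t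

time : List Event → ℕ
time = length

-- The first argument is the time already elapsed since the last output.
delaysFrom : ℕ → List Event → List ℕ
delaysFrom d []           = [ d ]
delaysFrom d (tick   ∷ t) = delaysFrom (suc d) t
delaysFrom d (emit _ ∷ t) = suc d ∷ delaysFrom 0 t

-- The times from the start to the first output, between consecutive
-- outputs, and from the last output to termination.
delays : List Event → List ℕ
delays = delaysFrom 0

-- Coefficients, constant term first.
Polynomial : Set
Polynomial = List ℕ

⟦_⟧ : Polynomial → ℕ → ℕ
⟦ [] ⟧    n = 0
⟦ a ∷ p ⟧ n = a + n * ⟦ p ⟧ n

------------------------------------------------------------------------
-- Enumeration problems

record EnumerationProblem : Set₁ where
  field
    Instance        : Set
    Candidate       : Instance → Set
    IsSolution      : ∀ i → Candidate i → Set
    encode          : Instance → Tree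
    encodeCandidate : ∀ i → Candidate i → Tree

module _ (P : EnumerationProblem) where
  open EnumerationProblem P

  ListsSolutions : Instance → List Tree → Set
  ListsSolutions i os =
    Σ[ sols ∈ List (Candidate i) ]
      Unique sols
    × (∀ s → s List.∈ sols ⇔ IsSolution i s)
    × os ≡ map (encodeCandidate i) sols

  SolvedWithin : Program → (Instance → List Event → Set) → Set
  SolvedWithin p Bound =
    ∀ i → ∃[ t ] ∃[ x ]
      ⟨ p , encode i ⟩⇓⟨ t , x ⟩ × ListsSolutions i (outputs t) × Bound i t

  OutputPolynomialTime : Set
  OutputPolynomialTime =
    Σ[ p ∈ Program ] Σ[ f ∈ Polynomial ] SolvedWithin p λ i t →
      time t ≤ ⟦ f ⟧ (size (encode i) + sum (map size (outputs t)))

  PolynomialDelay : Set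
  PolynomialDelay =
    Σ[ p ∈ Program ] Σ[ f ∈ Polynomial ] SolvedWithin p λ i t →
      All (_≤ ⟦ f ⟧ (size (encode i))) (delays t)

------------------------------------------------------------------------
-- Encodings

encodeBool : Bool → Tree
encodeBool false = nil
encodeBool true  = nil ∙ nil

encodeList : ∀ {A : Set} → (A → Tree) → List A → Tree
encodeList enc []       = nil
encodeList enc (a ∷ as) = enc a ∙ encodeList enc as

-- The digits of a number, least significant first, in bijective base 2
-- (true is the digit 2, false the digit 1).
digits : ℕᵇ → List Bool
digits zero     = []
digits 2[1+ n ] = true ∷ digits n
digits 1+[2 n ] = false ∷ digits n

encodeℕ : ℕ → Tree
encodeℕ n = encodeList encodeBool (digits (fromℕ n))

encodeSubset : ∀ {n} → Subset n → Tree
encodeSubset S = encodeList encodeBool (Vec.toList S)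

------------------------------------------------------------------------
-- Graphs

Minimal : ∀ {n} → (Subset n → Set) → Subset n → Set
Minimal P S = P S × (∀ {R} → R ⊂ S → ¬ P R)

record Graph : Set where
  field
    order       : ℕ
    adjacent    : Fin order → Fin order → Bool
    symmetric   : ∀ u v → adjacent u v ≡ adjacent v u
    irreflexive : ∀ v → adjacent v v ≡ false

  Vertex : Set
  Vertex = Fin order

  -- An edge {u , v} is represented by its endpoints in increasing order.
  record Edge : Set where
    constructor edge
    field
      {u v}   : Vertex
      ordered : u < v
      joined  : adjacent u v ≡ true

  edge? : Vertex → Vertex → Maybe Edge
  edge? u v = Maybe.map (λ (u<v , uv) → edge u<v uv)
    (dec⇒maybe ((u <? v) ×-dec (adjacent u v Bool.≟ true)))

  edges : List Edge
  edges = concatMap (λ u → mapMaybe (edge? u) (allFin order)) (allFin order)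

  neighbours : Vertex → Subset order
  neighbours v = Vec.tabulate (adjacent v)

  Bipartite : Set
  Bipartite = Σ[ side ∈ (Vertex → Bool) ]
    (∀ u v → adjacent u v ≡ true → side u ≢ side v)

  -- A vertex ordering is the sequence π 0 , π 1 , … of values of a
  -- permutation π; suffix π i consists of π i , π (i + 1) , ….
  suffix : Permutation′ order → Fin order → Subset order
  suffix π i = Vec.tabulate λ v → does (i ≤? π ⟨$⟩ˡ v)

  Degenerate : ℕ → Set
  Degenerate k = Σ[ π ∈ Permutation′ order ]
    (∀ i → ∣ neighbours (π ⟨$⟩ʳ i) ∩ suffix π i ∣ ≤ k)

module _ (G : Graph) (c : Graph.Vertex G → ℕ) where
  open Graph G

  record IsCapacitatedVertexCover (C : Subset order) : Set where
    field
      α        : Edge → Vertex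
      α∈C      : ∀ e → α e ∈ C
      incident : ∀ e → α e ≡ Edge.u e ⊎ α e ≡ Edge.v e
      capacity : ∀ v → v ∈ C → length (filter (λ e → α e ≟ v) edges) ≤ c v

-- A graph is given by its adjacency matrix, capacities in binary.
MinimalCapacitatedVertexCoverEnumeration : (Graph → Set) → EnumerationProblem
MinimalCapacitatedVertexCoverEnumeration Class = record
  { Instance        = Σ[ G ∈ Graph ] Class G × (Graph.Vertex G → ℕ)
  ; Candidate       = λ (G , _) → Subset (Graph.order G)
  ; IsSolution      = λ (G , _ , c) → Minimal (IsCapacitatedVertexCover G c)
  ; encode          = λ (G , _ , c) → let open Graph G in
      encodeList encodeSubset (tabulate neighbours) ∙ encodeList encodeℕ (tabulate c)
  ; encodeCandidate = λ _ → encodeSubset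
  }

------------------------------------------------------------------------
-- Hypergraphs

record Hypergraph : Set where
  field
    order      : ℕ
    hyperedges : List (Subset order)
    distinct   : Unique hyperedges

IsTransversal : (H : Hypergraph) → Subset (Hypergraph.order H) → Set
IsTransversal H S = ∀ {e} → e List.∈ Hypergraph.hyperedges H → Nonempty (S ∩ e)

-- A hypergraph is given by its order in unary (so that isolated vertices
-- count towards the input size) and its incidence matrix.
MinimalTransversalEnumeration : EnumerationProblem
MinimalTransversalEnumeration = record
  { Instance        = Hypergraph
  ; Candidate       = λ H → Subset (Hypergraph.order H)
  ; IsSolution      = λ H → Minimal (IsTransversal H)
  ; encode          = λ H → let open Hypergraph H in
      encodeList (λ _ → nil) (allFin order) ∙ encodeList encodeSubset hyperedges
  ; encodeCandidate = λ _ → encodeSubset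
  }

{-# OPTIONS --safe #-}

-- A hypergraph with vertices v < n becomes a graph with a vertex elem v
-- for each v and, for each hyperedge e, a path of vertices path e p with
-- p < 2 + n, where path e (1 + v) is joined to elem v if v ∈ e.  Every
-- path vertex has a pendant leaf of capacity 0, which forces it into all
-- covers, and its capacity is such that, after covering the edges to its
-- leaf and to elem v, it can cover one edge of the path (none if it is
-- an end).  The path has one edge more than that, so some path vertex
-- must be relieved of its edge to elem v: the elem v in a cover form a
-- transversal.  Conversely a single relieved vertex suffices, since each
-- path edge can be covered by its end nearer to that vertex.  The minimal covers are thus
-- the minimal transversals together with all path vertices.
--
-- A program for covers is turned into one for transversals by running it
-- on one half of the store, the other half holding what is needed to cut
-- each output down to the part about the elem v.

module Submission where

-- Attaching one vertex per hyperedge to all its members would give the incidence graph, whose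
-- degeneracy is unbounded. The path spreads a hyperedge over vertices with at most two neighbours
-- of larger number each, and the capacities turn the demand for a chosen member into a count:
-- `1 + n` path edges against `n` inner vertices with room for one each. The positions of
-- non-members are kept so that `elem v` faces position `1 + v` in every path; the parity of
-- positions is then a 2-colouring of the whole graph, which paths through the members alone would
-- not guarantee. Minimal covers and minimal transversals correspond one to one, so every output of
-- the given program becomes exactly one output of the new one. Hence delay is preserved: nothing
-- has to be filtered or remembered. For output-polynomial time it matters in addition that the
-- numbers of outputs agree and that the size of a cover is polynomial in that of the hypergraph.

open import Defs
open import Axiom.UniquenessOfIdentityProofs.WithK using (uip)
open import Data.Bool.Base using (Bool; true; false; not; _∧_; _∨_)
import Data.Bool.Properties as Bool
open import Data.Empty using (⊥; ⊥-elim)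
open import Data.Fin.Base using (Fin; zero; suc; toℕ; inject₁; fromℕ; _↑ˡ_; _↑ʳ_; splitAt; combine; remQuot)
open import Data.Fin.Induction using (<-weakInduction)
import Data.Fin.Permutation as Permutation
import Data.Fin.Properties as Fin
open import Data.Fin.Subset using (Subset; inside; outside; _∈_; _∉_; _⊆_; _⊂_; ∣_∣; _∩_)
open import Data.Fin.Subset.Properties using (_∈?_; x∈p∩q⁺; x∈p∩q⁻; nonempty?; ⊆-antisym)
import Data.List.Base as List
open List
  using (List; []; _∷_; [_]; _++_; length; map; concatMap; mapMaybe; filter; replicate; foldl;
    foldr; reverse; allFin; tabulate)
open import Data.List.Membership.Propositional using (find; lose) renaming (_∈_ to _∈ₗ_)
open import Data.List.Membership.Propositional.Properties
  using (∈-map⁺; ∈-map⁻; ∈-++⁺ˡ; ∈-++⁺ʳ; ∈-++⁻; ∈-∃++; ∈-concatMap⁺; ∈-concatMap⁻; ∈-filter⁺;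
    ∈-filter⁻; ∈-allFin; ∈-lookup)
open import Data.List.Properties
  using (++-assoc; ++-identityʳ; reverse-foldl; length-reverse; reverse-involutive;
    length-replicate; length-++; length-map; map-∘; map-cong; map-tabulate; tabulate-cong;
    tabulate-lookup; length-tabulate; map-concatMap; concatMap-cong)
open import Data.List.Relation.Unary.All using (All; []; _∷_)
import Data.List.Relation.Unary.All as All
import Data.List.Relation.Unary.All.Properties as All
open import Data.List.Relation.Unary.AllPairs using ([]; _∷_)
open import Data.List.Relation.Unary.Any using (here; there; index)
open import Data.List.Relation.Unary.Any.Properties using (lookup-index)
open import Data.List.Relation.Unary.Unique.Propositional using (Unique)
import Data.List.Relation.Unary.Unique.Propositional.Properties as Unique
open import Data.Maybe.Base using (just; nothing)
open import Data.Nat.Base using (ℕ; zero; suc; _+_; _*_; _∸_; _≤_; _<_; z≤n; s≤s; _≡ᵇ_)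
import Data.Nat.Binary.Base as ℕᵇ
open ℕᵇ using (ℕᵇ; 2[1+_]; 1+[2_])
import Data.Nat.Binary.Properties as ℕᵇ
open import Data.Nat.ListAction using (sum)
open import Data.Nat.Properties
open import Data.Nat.Solver using (module +-*-Solver)
open +-*-Solver using (solve; _:+_; _:*_; _:=_; con)
open import Data.Product.Base using (Σ; Σ-syntax; ∃-syntax; _×_; _,_; proj₁; proj₂; uncurry)
open import Data.Sum.Base using (_⊎_; inj₁; inj₂; [_,_]′; swap)
open import Data.Unit.Base using (⊤; tt)
open import Data.Vec.Base using (Vec; []; _∷_; here; there; lookup; toList)
import Data.Vec.Base as Vec
open import Data.Vec.Properties using (lookup∘tabulate; tabulate∘lookup; []=⇒lookup; lookup⇒[]=; length-toList)
import Data.Vec.Properties as Vec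
open import Function.Base using (_∘_; id; flip)
open import Function.Bundles using (_⇔_; mk⇔; Equivalence)
open import Relation.Binary.Definitions using (tri<; tri≈; tri>)
open import Relation.Binary.PropositionalEquality
  using (_≡_; _≢_; refl; sym; trans; cong; cong₂; subst; subst₂; module ≡-Reasoning)
open import Relation.Nullary using (¬_; yes; no; does; contradiction)
open import Relation.Nullary.Decidable using (decidable-stable)

-- Polynomial bounds

infixl 6 _⊞_

_⊞_ : Polynomial → Polynomial → Polynomial
[]      ⊞ q       = q
(a ∷ p) ⊞ []      = a ∷ p
(a ∷ p) ⊞ (b ∷ q) = (a + b) ∷ (p ⊞ q)

⟦⊞⟧ : ∀ p q n → ⟦ p ⊞ q ⟧ n ≡ ⟦ p ⟧ n + ⟦ q ⟧ n
⟦⊞⟧ []      q       n = refl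
⟦⊞⟧ (a ∷ p) []      n = sym (+-identityʳ _)
⟦⊞⟧ (a ∷ p) (b ∷ q) n rewrite ⟦⊞⟧ p q n =
  solve 5 (λ a b n x y → a :+ b :+ n :* (x :+ y) := a :+ n :* x :+ (b :+ n :* y))
    refl a b n (⟦ p ⟧ n) (⟦ q ⟧ n)

⟦scale⟧ : ∀ a q n → ⟦ map (a *_) q ⟧ n ≡ a * ⟦ q ⟧ n
⟦scale⟧ a []      n = sym (*-zeroʳ a)
⟦scale⟧ a (b ∷ q) n rewrite ⟦scale⟧ a q n =
  solve 4 (λ a b n y → a :* b :+ n :* (a :* y) := a :* (b :+ n :* y)) refl a b n (⟦ q ⟧ n)

infixl 7 _⊠_

_⊠_ : Polynomial → Polynomial → Polynomial
[]      ⊠ q = []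
(a ∷ p) ⊠ q = map (a *_) q ⊞ (0 ∷ p ⊠ q)

⟦⊠⟧ : ∀ p q n → ⟦ p ⊠ q ⟧ n ≡ ⟦ p ⟧ n * ⟦ q ⟧ n
⟦⊠⟧ []      q n = refl
⟦⊠⟧ (a ∷ p) q n rewrite ⟦⊞⟧ (map (a *_) q) (0 ∷ p ⊠ q) n | ⟦scale⟧ a q n | ⟦⊠⟧ p q n =
  solve 4 (λ a n x y → a :* y :+ n :* (x :* y) := (a :+ n :* x) :* y)
    refl a n (⟦ p ⟧ n) (⟦ q ⟧ n)

⟦⟧-mono-≤ : ∀ p {m n} → m ≤ n → ⟦ p ⟧ m ≤ ⟦ p ⟧ n
⟦⟧-mono-≤ []      m≤n = z≤n
⟦⟧-mono-≤ (a ∷ p) m≤n = +-monoʳ-≤ a (*-mono-≤ m≤n (⟦⟧-mono-≤ p m≤n))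

-- The polynomial is data because the complexity classes ask for it to be exhibited. As `N` may
-- ignore components of `a`, one polynomial can be uniform in them.
record Bounded {A : Set} (N g : A → ℕ) : Set where
  constructor _by_
  field
    bound  : Polynomial
    within : ∀ a → g a ≤ ⟦ bound ⟧ (N a)
open Bounded public

module _ {A : Set} {N : A → ℕ} where

  bounded-≤ : ∀ {f g} → (∀ a → f a ≤ g a) → Bounded N g → Bounded N f
  bounded-≤ f≤g (p by g≤p) = p by λ a → ≤-trans (f≤g a) (g≤p a)

  bounded-const : ∀ k → Bounded N (λ _ → k)
  bounded-const k = [ k ] by λ a → m≤m+n k _

  bounded-self : Bounded N N
  bounded-self = (0 ∷ 1 ∷ []) by λ a → ≤-reflexive
    (solve 1 (λ n → n := n :* (con 1 :+ n :* con 0)) refl (N a))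

  bounded-+ : ∀ {f g} → Bounded N f → Bounded N g → Bounded N (λ a → f a + g a)
  bounded-+ (p by f≤p) (q by g≤q) = (p ⊞ q) by λ a →
    ≤-trans (+-mono-≤ (f≤p a) (g≤q a)) (≤-reflexive (sym (⟦⊞⟧ p q (N a))))

  bounded-* : ∀ {f g} → Bounded N f → Bounded N g → Bounded N (λ a → f a * g a)
  bounded-* (p by f≤p) (q by g≤q) = (p ⊠ q) by λ a →
    ≤-trans (*-mono-≤ (f≤p a) (g≤q a)) (≤-reflexive (sym (⟦⊠⟧ p q (N a))))

  bounded-⟦_⟧ : ∀ p {g} → Bounded N g → Bounded N (λ a → ⟦ p ⟧ (g a))
  bounded-⟦ []    ⟧ b = bounded-const 0
  bounded-⟦ a ∷ p ⟧ b = bounded-+ (bounded-const a) (bounded-* b (bounded-⟦ p ⟧ b))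

  bounded-∘ : ∀ {B : Set} (h : B → A) {g} → Bounded N g → Bounded (N ∘ h) (g ∘ h)
  bounded-∘ h (p by g≤p) = p by (g≤p ∘ h)

-- Relocating programs in the store

ticks : ℕ → List Event
ticks k = replicate k tick

ticks-+ : ∀ j k → ticks j ++ ticks k ≡ ticks (j + k)
ticks-+ zero    k = refl
ticks-+ (suc j) k = cong (tick ∷_) (ticks-+ j k)

retrace : ∀ {p x y s t} → s ≡ t → ⟨ p , x ⟩⇓⟨ s , y ⟩ → ⟨ p , x ⟩⇓⟨ t , y ⟩
retrace refl r = r

retarget : ∀ {p x y z t} → y ≡ z → ⟨ p , x ⟩⇓⟨ t , y ⟩ → ⟨ p , x ⟩⇓⟨ t , z ⟩
retarget refl r = r

seq-ticks : ∀ {p q x y z} j {k} →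
  ⟨ p , x ⟩⇓⟨ ticks j , y ⟩ → ⟨ q , y ⟩⇓⟨ ticks k , z ⟩ →
  ⟨ p ⨾ q , x ⟩⇓⟨ ticks (j + k) , z ⟩
seq-ticks j {k} r s = retrace (ticks-+ j k) (seq r s)

onTail : Expr → Expr
onTail X          = tl X
onTail nil        = nil
onTail (cons e f) = cons (onTail e) (onTail f)
onTail (hd e)     = hd (onTail e)
onTail (tl e)     = tl (onTail e)

eval-onTail : ∀ e w x → eval (onTail e) (w ∙ x) ≡ eval e x
eval-onTail X          w x = refl
eval-onTail nil        w x = refl
eval-onTail (cons e f) w x = cong₂ _∙_ (eval-onTail e w x) (eval-onTail f w x)
eval-onTail (hd e)     w x = cong head (eval-onTail e w x)
eval-onTail (tl e)     w x = cong tail (eval-onTail e w x)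

-- Acts on the tail of the store only; out translates output
-- instructions, with access to the head.
relocate : (Expr → Program) → Program → Program
relocate out (X:= e)            = X:= cons (hd X) (onTail e)
relocate out (p ⨾ q)            = relocate out p ⨾ relocate out q
relocate out (if e then p else q) = if onTail e then relocate out p else relocate out q
relocate out (while e loop p)   = while onTail e loop relocate out p
relocate out (output e)         = out e

expand : (Tree → List Event) → List Event → List Event
expand τ []           = []
expand τ (tick   ∷ t) = tick ∷ expand τ t
expand τ (emit o ∷ t) = τ o ++ expand τ t

expand-++ : ∀ τ s t → expand τ (s ++ t) ≡ expand τ s ++ expand τ t
expand-++ τ []           t = refl
expand-++ τ (tick   ∷ s) t = cong (tick ∷_) (expand-++ τ s t)
expand-++ τ (emit o ∷ s) t =
  trans (cong (τ o ++_) (expand-++ τ s t)) (sym (++-assoc (τ o) (expand τ s) (expand τ t)))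

expand-ticks : ∀ τ k → expand τ (ticks k) ≡ ticks k
expand-ticks τ zero    = refl
expand-ticks τ (suc k) = cong (tick ∷_) (expand-ticks τ k)

module _ {out : Expr → Program} {w : Tree} (τ : Tree → List Event)
  (run-out : ∀ e x → ⟨ out e , w ∙ x ⟩⇓⟨ τ (eval e x) , w ∙ x ⟩) where

  -- Assignments copy the head and `run-out` has to restore the whole store, so `w` stays available
  -- throughout and induction on the run applies.
  run-relocate : ∀ {p x t y} → ⟨ p , x ⟩⇓⟨ t , y ⟩ →
                 ⟨ relocate out p , w ∙ x ⟩⇓⟨ expand τ t , w ∙ y ⟩
  run-relocate (assign {e} {x}) =
    retarget (cong (w ∙_) (eval-onTail e w x)) assign
  run-relocate (seq {s = s} {t} r r′) =
    retrace (sym (expand-++ τ s t)) (seq (run-relocate r) (run-relocate r′))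
  run-relocate (if-true {e} {x = x} c r) =
    if-true (c ∘ trans (sym (eval-onTail e w x))) (run-relocate r)
  run-relocate (if-false {e} {x = x} c r) =
    if-false (trans (eval-onTail e w x) c) (run-relocate r)
  run-relocate (while-true {e} {x = x} {s = s} {t} c r r′) =
    retrace (cong (tick ∷_) (sym (expand-++ τ s t)))
      (while-true (c ∘ trans (sym (eval-onTail e w x))) (run-relocate r) (run-relocate r′))
  run-relocate (while-false {e} {x = x} c) =
    while-false (trans (eval-onTail e w x) c)
  run-relocate (write {e} {x}) =
    retrace (sym (++-identityʳ (τ (eval e x)))) (run-out e x)

outputOnTail : Expr → Program
outputOnTail e = output onTail e

run-relocate-ticks : ∀ {p x y} k w → ⟨ p , x ⟩⇓⟨ ticks k , y ⟩ →
                     ⟨ relocate outputOnTail p , w ∙ x ⟩⇓⟨ ticks k , w ∙ y ⟩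
run-relocate-ticks k w r = retrace (expand-ticks _ k)
  (run-relocate (λ o → [ emit o ])
    (λ e x → retrace (cong (λ o → [ emit o ]) (eval-onTail e w x)) write) r)

-- Polynomial-time functions

-- A single program taking i a to o a for every a, silently and in time
-- polynomial in N a.  As N may be taken to be the size of the original
-- input throughout, no sizes of intermediate results need be tracked.
record Computes {A : Set} (N : A → ℕ) (i o : A → Tree) : Set where
  field
    program : Program
    steps   : A → ℕ
    bounded : Bounded N steps
    run     : ∀ a → ⟨ program , i a ⟩⇓⟨ ticks (steps a) , o a ⟩
open Computes public

select : ∀ {A : Set} → Tree → A → A → A
select nil     x y = y
select (_ ∙ _) x y = x

select-≤ : ∀ c m n → select c m n ≤ m + n
select-≤ nil     m n = m≤n+m n m
select-≤ (_ ∙ _) m n = m≤m+n m n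

unary : ℕ → Tree
unary k = encodeList encodeBool (replicate k false)

dropTree : ℕ → Tree → Tree
dropTree zero    s = s
dropTree (suc k) s = dropTree k (tail s)

numbered : ∀ {A : Set} → ℕ → List A → List (ℕ × A)
numbered k []       = []
numbered k (a ∷ as) = (k , a) ∷ numbered (suc k) as

module _ {A : Set} {N : A → ℕ} where

  expr : ∀ {i} e → Computes N i (λ a → eval e (i a))
  expr e = record
    { program = X:= e ; steps = λ _ → 1 ; bounded = bounded-const 1 ; run = λ _ → assign }

  infixr 4 _then_

  _then_ : ∀ {i j o} → Computes N i j → Computes N j o → Computes N i o
  c then d = record
    { program = program c ⨾ program d
    ; steps   = λ a → steps c a + steps d a
    ; bounded = bounded-+ (bounded c) (bounded d)
    ; run     = λ a → seq-ticks (steps c a) (run c a) (run d a)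
    }

  reindexed : ∀ {B : Set} (h : B → A) {i o} → Computes N i o → Computes (N ∘ h) (i ∘ h) (o ∘ h)
  reindexed h c = record
    { program = program c
    ; steps   = steps c ∘ h
    ; bounded = bounded-∘ h (bounded c)
    ; run     = run c ∘ h
    }

  outputting : ∀ {i o o′} → (∀ a → o a ≡ o′ a) → Computes N i o → Computes N i o′
  outputting eq c = record
    { program = program c ; steps = steps c ; bounded = bounded c
    ; run = λ a → retarget (eq a) (run c a) }

  keeping : ∀ {i o} (w : A → Tree) → Computes N i o →
            Computes N (λ a → w a ∙ i a) (λ a → w a ∙ o a)
  keeping w c = record
    { program = relocate outputOnTail (program c)
    ; steps   = steps c
    ; bounded = bounded c
    ; run     = λ a → run-relocate-ticks (steps c a) (w a) (run c a)
    }

  pair : ∀ {i o o′} → Computes N i o → Computes N i o′ → Computes N i (λ a → o a ∙ o′ a)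
  pair {i} {o} {o′} c d =
    -- One copy of the input waits in the head while `d` consumes the other; after a swap the result
    -- of `d` waits while `c` consumes the saved copy.
    expr (cons X X) then keeping i d
      then expr (cons (tl X) (hd X)) then keeping o′ c
      then expr (cons (tl X) (hd X))

  branch : ∀ {i c o o′} → Computes N i c → Computes N i o → Computes N i o′ →
           Computes N i (λ a → select (c a) (o a) (o′ a))
  branch {i} {c} {o} {o′} cc co co′ = expr (cons X X) then keeping i cc then record
    { program = if tl X then (X:= hd X ⨾ program co) else (X:= hd X ⨾ program co′)
    ; steps   = λ a → 2 + select (c a) (steps co a) (steps co′ a)
    ; bounded = bounded-+ (bounded-const 2)
        (bounded-≤ (λ a → select-≤ (c a) _ _) (bounded-+ (bounded co) (bounded co′)))
    ; run     = λ a → choose (c a) (run co a) (run co′ a)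
    }
    where
    choose : ∀ {p q x y y′ j k} c →
      ⟨ p , x ⟩⇓⟨ ticks j , y ⟩ → ⟨ q , x ⟩⇓⟨ ticks k , y′ ⟩ →
      ⟨ if tl X then (X:= hd X ⨾ p) else (X:= hd X ⨾ q) , x ∙ c ⟩⇓⟨ ticks (2 + select c j k) , select c y y′ ⟩
    choose nil     r s = if-false refl (seq assign s)
    choose (_ ∙ _) r s = if-true (λ ()) (seq assign r)

-- Loops over lists

module _ {A : Set} {N : A → ℕ} {B : A → Set} (xs : ∀ a → List (B a))
  (length-bounded : Bounded N (λ a → length (xs a))) where

  -- The body has to meet a bound in `N a` for every accumulator `s`. The cost of the loop is
  -- therefore the length of the list times a fixed polynomial, with no invariant on the size of the
  -- accumulator.
  foldingLeft : ∀ {i init env : A → Tree} {elt : ∀ a → B a → Tree} (g : ∀ a → B a → Tree → Tree) →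
    Computes N i (λ a → encodeList (elt a) (xs a)) →
    Computes N i env →
    Computes N i init →
    Computes {Σ[ a ∈ A ] B a × Tree} (N ∘ proj₁)
      (λ (a , b , s) → elt a b ∙ (env a ∙ s)) (λ (a , b , s) → g a b s) →
    Computes N i (λ a → foldl (λ s b → g a b s) (init a) (xs a))
  foldingLeft {init = init} {env} {elt} g list environment initial body =
    pair list (pair environment initial) then loop then expr (tl (tl X))
    where
    step : Computes {Σ[ a ∈ A ] B a × Tree} (N ∘ proj₁)
             (λ (a , b , s) → elt a b ∙ (env a ∙ s)) (λ (a , b , s) → env a ∙ g a b s)
    step = pair (expr (hd (tl X))) body

    unroll : Program
    unroll = while hd X loop
      -- The store goes from `(b ∙ rest) ∙ (env ∙ s)` to `rest ∙ (b ∙ (env ∙ s))`, so that `step`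
      -- can run on the tail while the rest of the list is kept in the head.
      (X:= cons (tl (hd X)) (cons (hd (hd X)) (tl X)) ⨾ relocate outputOnTail (program step))

    loopSteps : ∀ a → List (B a) → Tree → ℕ
    loopSteps a []       s = 1
    loopSteps a (b ∷ bs) s = 2 + (steps step (a , b , s) + loopSteps a bs (g a b s))

    run-loop : ∀ a bs s →
      ⟨ unroll , encodeList (elt a) bs ∙ (env a ∙ s) ⟩⇓⟨ ticks (loopSteps a bs s) ,
        nil ∙ (env a ∙ foldl (λ s b → g a b s) s bs) ⟩
    run-loop a []       s = while-false refl
    run-loop a (b ∷ bs) s = retrace
      (cong (λ t → tick ∷ tick ∷ t) (ticks-+ (steps step (a , b , s)) _))
      (while-true (λ ()) (seq assign (run-relocate-ticks (steps step (a , b , s)) _ (run step (a , b , s))))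
        (run-loop a bs (g a b s)))

    K = ⟦ bound (bounded step) ⟧

    loopSteps-≤ : ∀ a bs s → loopSteps a bs s ≤ 1 + length bs * (2 + K (N a))
    loopSteps-≤ a []       s = ≤-refl
    loopSteps-≤ a (b ∷ bs) s = ≤-trans
      (+-monoʳ-≤ 2 (+-mono-≤ (within (bounded step) (a , b , s)) (loopSteps-≤ a bs (g a b s))))
      (≤-reflexive (solve 2 (λ k r → con 2 :+ (k :+ (con 1 :+ r)) := con 1 :+ ((con 2 :+ k) :+ r))
        refl (K (N a)) (length bs * (2 + K (N a)))))

    loop : Computes N (λ a → encodeList (elt a) (xs a) ∙ (env a ∙ init a))
             (λ a → nil ∙ (env a ∙ foldl (λ s b → g a b s) (init a) (xs a)))
    loop = record
      { program = unroll
      ; steps   = λ a → loopSteps a (xs a) (init a)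
      ; bounded = bounded-≤ (λ a → loopSteps-≤ a (xs a) (init a))
          (bounded-+ (bounded-const 1) (bounded-* length-bounded
            (bounded-+ (bounded-const 2) (bounded-⟦ bound (bounded step) ⟧ bounded-self))))
      ; run     = λ a → run-loop a (xs a) (init a)
      }

  reversing : ∀ {i} {elt : ∀ a → B a → Tree} →
    Computes N i (λ a → encodeList (elt a) (xs a)) →
    Computes N i (λ a → encodeList (elt a) (reverse (xs a)))
  reversing {elt = elt} list = outputting (λ a → spec a [] (xs a))
    (foldingLeft (λ a b s → elt a b ∙ s) list (expr nil) (expr nil)
      (expr (cons (hd X) (tl (tl X)))))
    where
    spec : ∀ a acc bs → foldl (λ s b → elt a b ∙ s) (encodeList (elt a) acc) bs
                      ≡ encodeList (elt a) (foldl (flip _∷_) acc bs)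
    spec a acc []       = refl
    spec a acc (b ∷ bs) = spec a (b ∷ acc) bs

module _ {A : Set} {N : A → ℕ} {B : A → Set} (xs : ∀ a → List (B a))
  (length-bounded : Bounded N (λ a → length (xs a))) where

  foldingRight : ∀ {i init env : A → Tree} {elt : ∀ a → B a → Tree} (g : ∀ a → B a → Tree → Tree) →
    Computes N i (λ a → encodeList (elt a) (xs a)) →
    Computes N i env →
    Computes N i init →
    Computes {Σ[ a ∈ A ] B a × Tree} (N ∘ proj₁)
      (λ (a , b , s) → elt a b ∙ (env a ∙ s)) (λ (a , b , s) → g a b s) →
    Computes N i (λ a → foldr (g a) (init a) (xs a))
  foldingRight {init = init} g list environment initial body =
    outputting (λ a → reverse-foldl (flip (g a)) (init a) (xs a))
      (foldingLeft (reverse ∘ xs) (bounded-≤ (λ a → ≤-reflexive (length-reverse (xs a))) length-bounded)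
        g (reversing xs length-bounded list) environment initial body)

  mapping : ∀ {i env : A → Tree} {elt out : ∀ a → B a → Tree} →
    Computes N i (λ a → encodeList (elt a) (xs a)) →
    Computes N i env →
    Computes {Σ A B} (N ∘ proj₁) (λ (a , b) → elt a b ∙ env a) (λ (a , b) → out a b) →
    Computes N i (λ a → encodeList (out a) (xs a))
  mapping {env = env} {out = out} list environment body =
    outputting (λ a → spec a (xs a))
      (foldingRight (λ a b s → out a b ∙ s) list environment (expr nil)
        (pair (expr (cons (hd X) (hd (tl X))) then reindexed (λ (a , b , s) → a , b) body) (expr (tl (tl X)))))
    where
    spec : ∀ a bs → foldr (λ b s → out a b ∙ s) nil bs ≡ encodeList (out a) bs
    spec a []       = refl
    spec a (b ∷ bs) = cong (out a b ∙_) (spec a bs)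

  prepending : ∀ {i} {elt : ∀ a → B a → Tree} {ys : ∀ a → List (B a)} →
    Computes N i (λ a → encodeList (elt a) (xs a)) →
    Computes N i (λ a → encodeList (elt a) (ys a)) →
    Computes N i (λ a → encodeList (elt a) (xs a ++ ys a))
  prepending {elt = elt} {ys} list rest =
    outputting (λ a → spec a (xs a))
      (foldingRight (λ a b s → elt a b ∙ s) list (expr nil) rest (expr (cons (hd X) (tl (tl X)))))
    where
    spec : ∀ a bs → foldr (λ b s → elt a b ∙ s) (encodeList (elt a) (ys a)) bs
                  ≡ encodeList (elt a) (bs ++ ys a)
    spec a []       = refl
    spec a (b ∷ bs) = cong (elt a b ∙_) (spec a bs)

  -- The list acts as a loop counter; any list of the right length will do.
  dropping : ∀ {i s : A → Tree} {elt : ∀ a → B a → Tree} →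
    Computes N i (λ a → encodeList (elt a) (xs a)) →
    Computes N i s →
    Computes N i (λ a → dropTree (length (xs a)) (s a))
  dropping {s = s} list argument =
    outputting (λ a → spec (xs a) (s a))
      (foldingLeft xs length-bounded (λ _ _ s → tail s) list (expr nil) argument (expr (tl (tl (tl X)))))
    where
    spec : ∀ {a} (bs : List (B a)) s → foldl (λ s _ → tail s) s bs ≡ dropTree (length bs) s
    spec []       s = refl
    spec (b ∷ bs) s = spec bs (tail s)

  -- The accumulator carries the next index in unary in its head and the numbered list, in reverse,
  -- in its tail.
  numbering : ∀ {i} {elt : ∀ a → B a → Tree} →
    Computes N i (λ a → encodeList (elt a) (xs a)) →
    Computes N i (λ a → encodeList (λ (k , b) → unary k ∙ elt a b) (numbered 0 (xs a)))
  numbering {elt = elt} list =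
    outputting (λ a → cong (encodeList _) (reverse-involutive (numbered 0 (xs a))))
      (reversing (λ a → reverse (numbered 0 (xs a)))
        (bounded-≤ (λ a → ≤-reflexive (trans (length-reverse (numbered 0 (xs a))) (length-numbered 0 (xs a))))
          length-bounded)
        (outputting (λ a → cong tail (spec a 0 [] (xs a)))
          (foldingLeft xs length-bounded
            (λ a b s → (nil ∙ head s) ∙ ((head s ∙ elt a b) ∙ tail s)) list (expr nil) (expr (cons nil nil))
            (expr (cons (cons nil (hd (tl (tl X))))
                        (cons (cons (hd (tl (tl X))) (hd X)) (tl (tl (tl X))))))
          then expr (tl X))))
    where
    length-numbered : ∀ {C : Set} k (bs : List C) → length (numbered k bs) ≡ length bs
    length-numbered k []       = refl
    length-numbered k (b ∷ bs) = cong suc (length-numbered (suc k) bs)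

    spec : ∀ a k acc bs →
      foldl (λ s b → (nil ∙ head s) ∙ ((head s ∙ elt a b) ∙ tail s))
            (unary k ∙ encodeList (λ (k , b) → unary k ∙ elt a b) acc) bs
      ≡ unary (k + length bs) ∙ encodeList (λ (k , b) → unary k ∙ elt a b) (foldl (flip _∷_) acc (numbered k bs))
    spec a k acc []       rewrite +-identityʳ k           = refl
    spec a k acc (b ∷ bs) rewrite +-suc k (length bs) = spec a (suc k) ((k , b) ∷ acc) bs

module _ {A : Set} {N : A → ℕ} {B C : A → Set} (xs : ∀ a → List (B a)) (ys : ∀ a → B a → List (C a))
  (length-bounded : Bounded N (λ a → length (xs a)))
  (lengths-bounded : Bounded {Σ A B} (N ∘ proj₁) (λ (a , b) → length (ys a b))) where

  concatMapping : ∀ {i env : A → Tree} {elt : ∀ a → B a → Tree} {out : ∀ a → C a → Tree} →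
    Computes N i (λ a → encodeList (elt a) (xs a)) →
    Computes N i env →
    Computes {Σ A B} (N ∘ proj₁) (λ (a , b) → elt a b ∙ env a) (λ (a , b) → encodeList (out a) (ys a b)) →
    Computes N i (λ a → encodeList (out a) (concatMap (ys a) (xs a)))
  concatMapping {out = out} list environment body =
    outputting (λ a → spec a (xs a))
      (foldingRight xs length-bounded (λ a b s → foldr (λ c s → out a c ∙ s) s (ys a b))
        list environment (expr nil)
        (foldingRight (λ (a , b , _) → ys a b) (bounded-∘ (λ (a , b , s) → a , b) lengths-bounded)
          (λ (a , _) c s → out a c ∙ s)
          (expr (cons (hd X) (hd (tl X))) then reindexed (λ (a , b , s) → a , b) body)
          (expr nil) (expr (tl (tl X))) (expr (cons (hd X) (tl (tl X))))))
    where
    onto : ∀ a cs ds → foldr (λ c s → out a c ∙ s) (encodeList (out a) ds) cs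
                     ≡ encodeList (out a) (cs ++ ds)
    onto a []       ds = refl
    onto a (c ∷ cs) ds = cong (out a c ∙_) (onto a cs ds)

    spec : ∀ a bs → foldr (λ b s → foldr (λ c s → out a c ∙ s) s (ys a b)) nil bs
                  ≡ encodeList (out a) (concatMap (ys a) bs)
    spec a []       = refl
    spec a (b ∷ bs) = trans (cong (λ s → foldr (λ c s → out a c ∙ s) s (ys a b)) (spec a bs))
      (onto a (ys a b) (concatMap (ys a) bs))

-- Boolean connectives and comparison of unary numbers

module _ {A : Set} {N : A → ℕ} {i : A → Tree} where

  conjoining : ∀ {b c : A → Bool} → Computes N i (encodeBool ∘ b) → Computes N i (encodeBool ∘ c) →
               Computes N i (λ a → encodeBool (b a ∧ c a))
  conjoining {b} {c} p q = outputting (λ a → spec (b a) (c a)) (branch p q (expr nil))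
    where
    spec : ∀ b c → select (encodeBool b) (encodeBool c) nil ≡ encodeBool (b ∧ c)
    spec false c = refl
    spec true  c = refl

  disjoining : ∀ {b c : A → Bool} → Computes N i (encodeBool ∘ b) → Computes N i (encodeBool ∘ c) →
               Computes N i (λ a → encodeBool (b a ∨ c a))
  disjoining {b} {c} p q = outputting (λ a → spec (b a) (c a)) (branch p (expr (cons nil nil)) q)
    where
    spec : ∀ b c → select (encodeBool b) (nil ∙ nil) (encodeBool c) ≡ encodeBool (b ∨ c)
    spec false c = refl
    spec true  c = refl

  -- Two numbers are equal when both truncated differences vanish. Dropping one numeral from another
  -- computes such a difference, since `tail nil` is `nil`.
  comparing : ∀ {k l : A → ℕ} → Bounded N k → Bounded N l →
    Computes N i (unary ∘ k) → Computes N i (unary ∘ l) →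
    Computes N i (λ a → encodeBool (k a ≡ᵇ l a))
  comparing {k} {l} k-bounded l-bounded p q =
    outputting (λ a → spec (k a) (l a))
      (branch (difference k-bounded p q) (expr nil)
        (branch (difference l-bounded q p) (expr nil) (expr (cons nil nil))))
    where
    dropTree-unary : ∀ k l → dropTree (length (replicate k false)) (unary l) ≡ unary (l ∸ k)
    dropTree-unary zero    l       = refl
    dropTree-unary (suc k) zero    = trans (dropTree-unary k 0) (cong unary (0∸n≡0 k))
    dropTree-unary (suc k) (suc l) = dropTree-unary k l

    difference : ∀ {k l : A → ℕ} → Bounded N k →
      Computes N i (unary ∘ k) → Computes N i (unary ∘ l) → Computes N i (λ a → unary (l a ∸ k a))
    difference {k} {l} b p q = outputting (λ a → dropTree-unary (k a) (l a))
      (dropping (λ a → replicate (k a) false) (bounded-≤ (λ a → ≤-reflexive (length-replicate (k a))) b) p q)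

    spec : ∀ k l → select (unary (l ∸ k)) nil (select (unary (k ∸ l)) nil (nil ∙ nil)) ≡ encodeBool (k ≡ᵇ l)
    spec zero    zero    = refl
    spec zero    (suc l) = refl
    spec (suc k) zero    = refl
    spec (suc k) (suc l) = spec k l

-- Reductions between enumeration problems

-- Injectivity is asked for on the list alone, because maps such as `back` are injective only on
-- solutions.
map-unique : ∀ {A B : Set} (f : A → B) {xs} →
  (∀ {x y} → x ∈ₗ xs → y ∈ₗ xs → f x ≡ f y → x ≡ y) → Unique xs → Unique (map f xs)
map-unique f inj []        = []
map-unique f inj (x∉ ∷ ux) =
  All.map⁺ (All.tabulate λ y∈ fx≡fy → All.lookup x∉ y∈ (inj (here refl) (there y∈) fx≡fy))
  ∷ map-unique f (λ p q → inj (there p) (there q)) ux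

length≤sum-size : ∀ os → length os ≤ sum (map size os)
length≤sum-size []       = z≤n
length≤sum-size (o ∷ os) = +-mono-≤ (1≤size o) (length≤sum-size os)
  where
  1≤size : ∀ t → 1 ≤ size t
  1≤size nil     = ≤-refl
  1≤size (_ ∙ _) = s≤s z≤n

sum-map-≤ : ∀ {A : Set} (f : A → ℕ) {b} xs → (∀ x → f x ≤ b) → sum (map f xs) ≤ length xs * b
sum-map-≤ f []       f≤b = z≤n
sum-map-≤ f (x ∷ xs) f≤b = +-mono-≤ (f≤b x) (sum-map-≤ f xs f≤b)

outputs-++ : ∀ s t → outputs (s ++ t) ≡ outputs s ++ outputs t
outputs-++ []           t = refl
outputs-++ (tick   ∷ s) t = outputs-++ s t
outputs-++ (emit o ∷ s) t = cong (o ∷_) (outputs-++ s t)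

outputs-ticks : ∀ k t → outputs (ticks k ++ t) ≡ outputs t
outputs-ticks zero    t = refl
outputs-ticks (suc k) t = outputs-ticks k t

delaysFrom-ticks : ∀ d k t → delaysFrom d (ticks k ++ t) ≡ delaysFrom (k + d) t
delaysFrom-ticks d zero    t = refl
delaysFrom-ticks d (suc k) t =
  trans (delaysFrom-ticks (suc d) k t) (cong (λ n → delaysFrom n t) (+-suc k d))

-- The advice is kept in the store, beside that of the program for Q, to
-- decode its outputs.
record Reduction (P Q : EnumerationProblem) : Set₁ where
  private
    module P = EnumerationProblem P
    module Q = EnumerationProblem Q
  inputSize : P.Instance → ℕ
  inputSize i = size (P.encode i)
  field
    translate      : P.Instance → Q.Instance
    advice         : P.Instance → Tree
    decode         : P.Instance → Tree → Tree
    translating    : Computes inputSize P.encode (λ i → advice i ∙ Q.encode (translate i))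
    decoding       : Computes {P.Instance × Tree} (inputSize ∘ proj₁)
                       (λ (i , o) → advice i ∙ o) (λ (i , o) → decode i o)
    size-bounded   : Bounded inputSize (size ∘ Q.encode ∘ translate)
    output-bounded : Bounded {Σ[ i ∈ P.Instance ] Q.Candidate (translate i)} (inputSize ∘ proj₁)
                       (λ (i , C) → size (Q.encodeCandidate (translate i) C))
    back           : ∀ i → Q.Candidate (translate i) → P.Candidate i
    forth          : ∀ i → P.Candidate i → Q.Candidate (translate i)
    decode-encode  : ∀ i C → decode i (Q.encodeCandidate (translate i) C) ≡ P.encodeCandidate i (back i C)
    back-solution  : ∀ i {C} → Q.IsSolution (translate i) C → P.IsSolution i (back i C)
    forth-solution : ∀ i {S} → P.IsSolution i S → Q.IsSolution (translate i) (forth i S)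
    back-forth     : ∀ i S → back i (forth i S) ≡ S
    forth-back     : ∀ i {C} → Q.IsSolution (translate i) C → forth i (back i C) ≡ C

module _ {P Q : EnumerationProblem} (R : Reduction P Q) where
  private
    module P = EnumerationProblem P
    module Q = EnumerationProblem Q
  open Reduction R

  decodeAndOutput : Expr → Program
  decodeAndOutput e =
    -- The whole store is saved in the head, so that the final `X:= hd X` restores it and the
    -- simulated program goes on undisturbed.
    X:= cons X (cons (hd X) (onTail e)) ⨾
    relocate outputOnTail (program decoding) ⨾
    output tl X ⨾
    X:= hd X

  decodeTrace : P.Instance → Tree → List Event
  decodeTrace i o = tick ∷ (ticks (steps decoding (i , o)) ++ emit (decode i o) ∷ tick ∷ [])

  run-decodeAndOutput : ∀ i e x →
    ⟨ decodeAndOutput e , advice i ∙ x ⟩⇓⟨ decodeTrace i (eval e x) , advice i ∙ x ⟩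
  run-decodeAndOutput i e x rewrite sym (eval-onTail e (advice i) x) =
    seq assign (seq (run-relocate-ticks (steps decoding (i , _)) _ (run decoding (i , _))) (seq write assign))

  compile : Program → Program
  compile p = program translating ⨾ relocate decodeAndOutput p

  compiledTrace : P.Instance → List Event → List Event
  compiledTrace i t = ticks (steps translating i) ++ expand (decodeTrace i) t

  run-compile : ∀ i {p t y} → ⟨ p , Q.encode (translate i) ⟩⇓⟨ t , y ⟩ →
                ⟨ compile p , P.encode i ⟩⇓⟨ compiledTrace i t , advice i ∙ y ⟩
  run-compile i r = seq (run translating i) (run-relocate (decodeTrace i) (run-decodeAndOutput i) r)

  outputs-compiled : ∀ i t → outputs (compiledTrace i t) ≡ map (decode i) (outputs t)
  outputs-compiled i t = trans (outputs-ticks (steps translating i) _) (go t)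
    where
    go : ∀ t → outputs (expand (decodeTrace i) t) ≡ map (decode i) (outputs t)
    go []           = refl
    go (tick   ∷ t) = go t
    go (emit o ∷ t) = trans (outputs-++ (decodeTrace i o) _)
      (cong₂ _++_ (outputs-ticks (steps decoding (i , o)) _) (go t))

  -- By `forth-back`, `back` is injective on solutions, so nothing is output twice; by `back-forth`
  -- and `forth-solution`, nothing is missed.
  listsSolutions : ∀ i {os} → ListsSolutions Q (translate i) os → ListsSolutions P i (map (decode i) os)
  listsSolutions i (sols , unique , complete , refl) =
    map (back i) sols , map-unique (back i) injective unique , complete′ ,
    trans (sym (map-∘ sols)) (trans (map-cong (decode-encode i) sols) (map-∘ sols))
    where
    solution : ∀ {C} → C ∈ₗ sols → Q.IsSolution (translate i) C
    solution = Equivalence.to (complete _)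

    injective : ∀ {C D} → C ∈ₗ sols → D ∈ₗ sols → back i C ≡ back i D → C ≡ D
    injective C∈ D∈ eq = trans (sym (forth-back i (solution C∈)))
      (trans (cong (forth i) eq) (forth-back i (solution D∈)))

    complete′ : ∀ S → S ∈ₗ map (back i) sols ⇔ P.IsSolution i S
    complete′ S = mk⇔
      (λ S∈ → let (C , C∈ , S≡) = ∈-map⁻ (back i) S∈ in
        subst (P.IsSolution i) (sym S≡) (back-solution i (solution C∈)))
      (λ S-sol → subst (_∈ₗ map (back i) sols) (back-forth i S)
        (∈-map⁺ (back i) (Equivalence.from (complete _) (forth-solution i S-sol))))

  -- The 3 counts the output itself and the two assignments that save and restore the store.
  overhead : P.Instance → ℕ
  overhead i = 3 + ⟦ bound (bounded decoding) ⟧ (inputSize i)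

  overhead-bounded : Bounded inputSize overhead
  overhead-bounded = bounded-+ (bounded-const 3) (bounded-⟦ bound (bounded decoding) ⟧ bounded-self)

  decodeTrace-≤ : ∀ i o → time (decodeTrace i o) ≤ overhead i
  decodeTrace-≤ i o
    rewrite length-++ (ticks (steps decoding (i , o))) {emit (decode i o) ∷ tick ∷ []}
          | length-replicate (steps decoding (i , o)) {tick}
          | +-comm (steps decoding (i , o)) 2 = +-monoʳ-≤ 3 (within (bounded decoding) (i , o))

  time-compiled : ∀ i t → time (compiledTrace i t) ≤ steps translating i + time t * overhead i
  time-compiled i t
    rewrite length-++ (ticks (steps translating i)) {expand (decodeTrace i) t}
          | length-replicate (steps translating i) {tick} = +-monoʳ-≤ (steps translating i) (go t)
    where
    go : ∀ t → time (expand (decodeTrace i) t) ≤ time t * overhead i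
    go []           = z≤n
    go (tick   ∷ t) = +-mono-≤ (s≤s z≤n) (go t)
    go (emit o ∷ t) rewrite length-++ (decodeTrace i o) {expand (decodeTrace i) t} =
      +-mono-≤ (decodeTrace-≤ i o) (go t)

  delays-compiled : ∀ i D t → All (_≤ D) (delays t) →
    All (_≤ steps translating i + suc D * overhead i) (delays (compiledTrace i t))
  delays-compiled i D t ds = subst (All (_≤ s + suc D * c)) (sym (delaysFrom-ticks 0 s _))
    (go 0 (s + 0) t (+-monoʳ-≤ s z≤n) ds)
    where
    s = steps translating i
    c = overhead i

    -- d and d′ are the times since the last output in the given run and
    -- in the compiled one.  Each unit of the former costs at most c in
    -- the latter; the extra c pays for finishing an earlier output.
    go : ∀ d d′ t → d′ ≤ s + suc d * c → All (_≤ D) (delaysFrom d t) →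
         All (_≤ s + suc D * c) (delaysFrom d′ (expand (decodeTrace i) t))
    go d d′ []           d′≤ (d≤D ∷ []) = ≤-trans d′≤ (+-monoʳ-≤ s (*-monoˡ-≤ c (s≤s d≤D))) ∷ []
    go d d′ (tick   ∷ t) d′≤ ds = go (suc d) (suc d′) t
      (≤-trans (+-mono-≤ {1} {c} (s≤s z≤n) d′≤)
        (≤-reflexive (solve 3 (λ s c x → c :+ (s :+ x) := s :+ (c :+ x)) refl s c (suc d * c)))) ds
    go d d′ (emit o ∷ t) d′≤ (d<D ∷ ds) = subst (All (_≤ s + suc D * c)) (sym eq)
      (≤-trans fits (+-monoʳ-≤ s (*-monoˡ-≤ c (s≤s d<D)))
       -- The new count restarts at 1: the assignment that restores the store runs after the output.
       ∷ go 0 1 t (≤-trans {1} {1 * c} (s≤s z≤n) (m≤n+m (1 * c) s)) ds)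
      where
      k = steps decoding (i , o)
      eq : delaysFrom d′ (decodeTrace i o ++ expand (decodeTrace i) t)
         ≡ suc (k + suc d′) ∷ delaysFrom 1 (expand (decodeTrace i) t)
      eq = trans (cong (delaysFrom (suc d′)) (assoc k)) (delaysFrom-ticks (suc d′) k _)
        where
        assoc : ∀ k → (ticks k ++ emit (decode i o) ∷ tick ∷ []) ++ expand (decodeTrace i) t
                    ≡ ticks k ++ (emit (decode i o) ∷ tick ∷ expand (decodeTrace i) t)
        assoc zero    = refl
        assoc (suc k) = cong (tick ∷_) (assoc k)
      fits : suc (k + suc d′) ≤ s + suc (suc d) * c
      fits = ≤-trans (≤-reflexive (solve 2 (λ k d → con 1 :+ (k :+ (con 1 :+ d)) := (con 2 :+ k) :+ d) refl k d′))
        (≤-trans (+-mono-≤ (≤-trans (n≤1+n (2 + k)) (+-monoʳ-≤ 3 (within (bounded decoding) (i , o)))) d′≤)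
          (≤-reflexive (solve 3 (λ s c x → c :+ (s :+ x) := s :+ (c :+ x)) refl s c (suc d * c))))

  polynomialDelay : PolynomialDelay Q → PolynomialDelay P
  polynomialDelay (p , f , solved) = compile p , bound total , λ i →
    let (t , y , r , lists , ds) = solved (translate i) in
    compiledTrace i t , advice i ∙ y , run-compile i r ,
    subst (ListsSolutions P i) (sym (outputs-compiled i t)) (listsSolutions i lists) ,
    All.map (λ d≤ → ≤-trans d≤ (within total i)) (delays-compiled i _ t ds)
    where
    total : Bounded inputSize
      (λ i → steps translating i + suc (⟦ f ⟧ (size (Q.encode (translate i)))) * overhead i)
    total = bounded-+ (bounded translating)
      (bounded-* (bounded-+ (bounded-const 1) (bounded-⟦ f ⟧ size-bounded)) overhead-bounded)

  outputPolynomialTime : OutputPolynomialTime Q → OutputPolynomialTime P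
  outputPolynomialTime (p , f , solved) = compile p , bound total , λ i →
    let (t , y , r , lists , t≤) = solved (translate i) in
    compiledTrace i t , advice i ∙ y , run-compile i r ,
    subst (ListsSolutions P i) (sym (outputs-compiled i t)) (listsSolutions i lists) ,
    (let open ≤-Reasoning
         o = sum (map size (outputs (compiledTrace i t)))
         s = steps translating i
         c = overhead i
         n = size (Q.encode (translate i))
     in begin
       time (compiledTrace i t)
         ≤⟨ time-compiled i t ⟩
       s + time t * c
         ≤⟨ +-monoʳ-≤ s (*-monoˡ-≤ c t≤) ⟩
       s + ⟦ f ⟧ (n + sum (map size (outputs t))) * c
         ≤⟨ +-monoʳ-≤ s (*-monoˡ-≤ c (⟦⟧-mono-≤ f (+-monoʳ-≤ n (outputs-≤ i t lists)))) ⟩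
       s + ⟦ f ⟧ (n + o * ⟦ bound output-bounded ⟧ (inputSize i)) * c
         ≤⟨ within total (i , o) ⟩
       ⟦ bound total ⟧ (inputSize i + o) ∎)
    where
    combined : P.Instance × ℕ → ℕ
    combined (i , o) = inputSize i + o

    lift : ∀ {g} → Bounded inputSize g → Bounded combined (g ∘ proj₁)
    lift b = bounded-≤ (λ (i , o) → within b i)
      (bounded-⟦ bound b ⟧ (bounded-≤ (λ (i , o) → m≤m+n _ o) bounded-self))

    total : Bounded combined (λ (i , o) → steps translating i +
      ⟦ f ⟧ (size (Q.encode (translate i)) + o * ⟦ bound output-bounded ⟧ (inputSize i)) * overhead i)
    total = bounded-+ (lift (bounded translating))
      (bounded-* (bounded-⟦ f ⟧ (bounded-+ (lift size-bounded)
        (bounded-* (bounded-≤ (λ (i , o) → m≤n+m o _) bounded-self)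
          (lift (bounded-⟦ bound output-bounded ⟧ bounded-self)))))
        (lift overhead-bounded))

    -- The time of the given program is bounded in terms of its own outputs, which may be larger
    -- than the decoded ones. There are equally many of both, each decoded output has size at least
    -- 1, and each original one is polynomial in the input.
    outputs-≤ : ∀ i t → ListsSolutions Q (translate i) (outputs t) →
      sum (map size (outputs t)) ≤
      sum (map size (outputs (compiledTrace i t))) * ⟦ bound output-bounded ⟧ (inputSize i)
    outputs-≤ i t (sols , _ , _ , os≡) = begin
      sum (map size (outputs t))
        ≡⟨ cong (sum ∘ map size) os≡ ⟩
      sum (map size (map enc sols))
        ≡⟨ cong sum (map-∘ sols) ⟨
      sum (map (size ∘ enc) sols)
        ≤⟨ sum-map-≤ (size ∘ enc) sols (λ C → within output-bounded (i , C)) ⟩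
      length sols * b
        ≡⟨ cong (_* b) same-length ⟩
      length (outputs (compiledTrace i t)) * b
        ≤⟨ *-monoˡ-≤ b (length≤sum-size (outputs (compiledTrace i t))) ⟩
      sum (map size (outputs (compiledTrace i t))) * b ∎
      where
      open ≤-Reasoning
      enc = Q.encodeCandidate (translate i)
      b   = ⟦ bound output-bounded ⟧ (inputSize i)
      same-length : length sols ≡ length (outputs (compiledTrace i t))
      same-length = sym (trans (cong length (outputs-compiled i t))
        (trans (length-map (decode i) (outputs t))
          (trans (cong length os≡) (length-map enc sols))))

-- Counting by lists without repetition

-- The pigeonhole principle without decidable equality: the occurrence of the first element is cut
-- out of `ys`, and the remaining elements of `xs` still fit, being different from it.
unique-length-≤ : ∀ {A : Set} {xs ys : List A} → Unique xs → (∀ {x} → x ∈ₗ xs → x ∈ₗ ys) →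
                  length xs ≤ length ys
unique-length-≤ []       sub = z≤n
unique-length-≤ {xs = x ∷ xs} (x∉ ∷ u) sub with ∈-∃++ (sub (here refl))
... | ys , zs , refl = begin
  suc (length xs)            ≤⟨ s≤s (unique-length-≤ u remaining) ⟩
  suc (length (ys ++ zs))    ≡⟨ cong suc (length-++ ys) ⟩
  suc (length ys + length zs) ≡⟨ +-suc (length ys) (length zs) ⟨
  length ys + suc (length zs) ≡⟨ length-++ ys ⟨
  length (ys ++ x ∷ zs)      ∎
  where
  open ≤-Reasoning
  remaining : ∀ {y} → y ∈ₗ xs → y ∈ₗ ys ++ zs
  remaining y∈ with ∈-++⁻ ys (sub (there y∈))
  ... | inj₁ y∈ys         = ∈-++⁺ˡ y∈ys
  ... | inj₂ (there y∈zs) = ∈-++⁺ʳ ys y∈zs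
  ... | inj₂ (here refl)  = contradiction refl (All.lookup x∉ y∈)

elements : ∀ {n} (p : Subset n) →
  Σ[ L ∈ List (Fin n) ] Unique L × (∀ {x} → x ∈ₗ L → x ∈ p) × length L ≡ ∣ p ∣
elements []            = [] , [] , (λ ()) , refl
elements (outside ∷ p) = let (L , u , L⊆p , len) = elements p in
  map suc L , Unique.map⁺ Fin.suc-injective u ,
  (λ x∈ → let (y , y∈ , x≡) = ∈-map⁻ suc x∈ in subst (_∈ _) (sym x≡) (there (L⊆p y∈))) ,
  trans (length-map suc L) len
elements (inside  ∷ p) = let (L , u , L⊆p , len) = elements p in
  zero ∷ map suc L , All.map⁺ (All.tabulate λ _ ()) ∷ Unique.map⁺ Fin.suc-injective u ,
  (λ { (here refl) → here
     ; (there x∈) → let (y , y∈ , x≡) = ∈-map⁻ suc x∈ in subst (_∈ _) (sym x≡) (there (L⊆p y∈)) }) ,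
  cong suc (trans (length-map suc L) len)

-- u covers v means that the edge {u , v} is assigned to u.
record Covering {V : Set} (adj : V → V → Bool) (cap : V → ℕ) (C : V → Set) : Set₁ where
  field
    _covers_ : V → V → Set
    total    : ∀ u v → adj u v ≡ true → u covers v ⊎ v covers u
    chosen   : ∀ {u v} → adj u v ≡ true → u covers v → C u
    respects   : ∀ u L → Unique L → (∀ {v} → v ∈ₗ L → adj u v ≡ true × u covers v) → length L ≤ cap u

-- Vertex covers of graphs as covering relations

module _ (G : Graph) where
  open Graph G

  edge-≡ : ∀ {e f : Edge} → Edge.u e ≡ Edge.u f → Edge.v e ≡ Edge.v f → e ≡ f
  edge-≡ {edge o j} {edge o′ j′} refl refl
    rewrite Fin.<-irrelevant o o′ | uip j j′ = refl

  edge?-sound : ∀ u v {e} → edge? u v ≡ just e → Edge.u e ≡ u × Edge.v e ≡ v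
  edge?-sound u v eq with u Fin.<? v | adjacent u v Bool.≟ true
  edge?-sound u v refl | yes _ | yes _ = refl , refl
  edge?-sound u v ()   | yes _ | no  _
  edge?-sound u v ()   | no  _ | yes _
  edge?-sound u v ()   | no  _ | no  _

  edge?-complete : ∀ (e : Edge) → edge? (Edge.u e) (Edge.v e) ≡ just e
  edge?-complete (edge {u} {v} o j) with u Fin.<? v | adjacent u v Bool.≟ true
  ... | yes _ | yes _ = cong just (edge-≡ refl refl)
  ... | no ¬o | _     = contradiction o ¬o
  ... | yes _ | no ¬j = contradiction j ¬j

  ∈-edgesFrom⁻ : ∀ u xs {e} → e ∈ₗ mapMaybe (edge? u) xs → Edge.u e ≡ u × Edge.v e ∈ₗ xs
  ∈-edgesFrom⁻ u (x ∷ xs) e∈ with edge? u x in eq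
  ... | nothing = let (p , q) = ∈-edgesFrom⁻ u xs e∈ in p , there q
  ∈-edgesFrom⁻ u (x ∷ xs) (here refl) | just _ = let (p , q) = edge?-sound u x eq in p , here q
  ∈-edgesFrom⁻ u (x ∷ xs) (there e∈)  | just _ = let (p , q) = ∈-edgesFrom⁻ u xs e∈ in p , there q

  edgesFrom-unique : ∀ u {xs} → Unique xs → Unique (mapMaybe (edge? u) xs)
  edgesFrom-unique u []                     = []
  edgesFrom-unique u {x ∷ xs} (x∉ ∷ ux) with edge? u x in eq
  ... | nothing = edgesFrom-unique u ux
  ... | just e  = All.tabulate fresh ∷ edgesFrom-unique u ux
    where
    fresh : ∀ {f} → f ∈ₗ mapMaybe (edge? u) xs → e ≢ f
    fresh f∈ refl = All.lookup x∉ (proj₂ (∈-edgesFrom⁻ u xs f∈)) (sym (proj₂ (edge?-sound u x eq)))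

  edges-unique : Unique edges
  edges-unique = go (Unique.allFin⁺ order)
    where
    go : ∀ {us} → Unique us → Unique (concatMap (λ u → mapMaybe (edge? u) (allFin order)) us)
    go []         = []
    go {u ∷ us} (u∉ ∷ uu) = Unique.++⁺ (edgesFrom-unique u (Unique.allFin⁺ order)) (go uu)
      λ (e∈ , e∈′) → let
        (w , w∈ , e∈w) = ∈-∃ e∈′
        in All.lookup u∉ w∈ (trans (sym (proj₁ (∈-edgesFrom⁻ u (allFin order) e∈))) (proj₁ (∈-edgesFrom⁻ w (allFin order) e∈w)))
      where
      ∈-∃ : ∀ {e} → e ∈ₗ concatMap (λ u → mapMaybe (edge? u) (allFin order)) us →
            ∃[ w ] w ∈ₗ us × e ∈ₗ mapMaybe (edge? w) (allFin order)
      ∈-∃ e∈ = find (∈-concatMap⁻ (λ u → mapMaybe (edge? u) (allFin order)) e∈)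

  ∈-edges : ∀ e → e ∈ₗ edges
  ∈-edges e = ∈-concatMap⁺ (λ u → mapMaybe (edge? u) (allFin order))
    (lose (∈-allFin (Edge.u e)) (from (allFin order) (∈-allFin (Edge.v e))))
    where
    from : ∀ xs → Edge.v e ∈ₗ xs → e ∈ₗ mapMaybe (edge? (Edge.u e)) xs
    from (x ∷ xs) (here refl) rewrite edge?-complete e = here refl
    from (x ∷ xs) (there v∈) with edge? (Edge.u e) x
    ... | nothing = from xs v∈
    ... | just _  = there (from xs v∈)

  edgeBetween : ∀ u v → adjacent u v ≡ true →
    Σ[ e ∈ Edge ] (Edge.u e ≡ u × Edge.v e ≡ v ⊎ Edge.u e ≡ v × Edge.v e ≡ u)
  edgeBetween u v uv with Fin.<-cmp u v
  ... | tri< u<v _ _    = edge u<v uv , inj₁ (refl , refl)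
  ... | tri> _ _ v<u    = edge v<u (trans (symmetric v u) uv) , inj₂ (refl , refl)
  ... | tri≈ _ refl _   = contradiction (trans (sym (irreflexive u)) uv) λ ()

  edge-≡′ : ∀ {e f : Edge} → Edge.u e ≡ Edge.v f → Edge.v e ≡ Edge.u f → ⊥
  edge-≡′ {edge o _} {edge o′ _} refl refl = Fin.<-asym o o′

  module _ (c : Vertex → ℕ) {C : Subset order} where

    covering : IsCapacitatedVertexCover G c C → Covering adjacent c (_∈ C)
    covering cover = record
      -- Quantifying over the proof of adjacency makes this a relation on all pairs. It holds
      -- vacuously for non-adjacent ones, about which no field of `Covering` speaks.
      { _covers_ = λ u v → ∀ (uv : adjacent u v ≡ true) → α (proj₁ (edgeBetween u v uv)) ≡ u
      ; total    = total
      ; chosen   = λ uv cov → subst (_∈ C) (cov uv) (α∈C _)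
      ; respects   = respects
      }
      where
      open IsCapacitatedVertexCover cover
      same : ∀ u v uv vu → proj₁ (edgeBetween v u vu) ≡ proj₁ (edgeBetween u v uv)
      same u v uv vu with edgeBetween u v uv | edgeBetween v u vu
      ... | e , inj₁ (p , q) | f , inj₁ (p′ , q′) = ⊥-elim (edge-≡′ {e} {f} (trans p (sym q′)) (trans q (sym p′)))
      ... | e , inj₁ (p , q) | f , inj₂ (p′ , q′) = edge-≡ (trans p′ (sym p)) (trans q′ (sym q))
      ... | e , inj₂ (p , q) | f , inj₁ (p′ , q′) = edge-≡ (trans p′ (sym p)) (trans q′ (sym q))
      ... | e , inj₂ (p , q) | f , inj₂ (p′ , q′) = ⊥-elim (edge-≡′ {e} {f} (trans p (sym q′)) (trans q (sym p′)))

      end : ∀ u v uv → α (proj₁ (edgeBetween u v uv)) ≡ u ⊎ α (proj₁ (edgeBetween u v uv)) ≡ v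
      end u v uv with edgeBetween u v uv
      ... | e , ends with incident e | ends
      ... | inj₁ x | inj₁ (p , q) = inj₁ (trans x p)
      ... | inj₂ x | inj₁ (p , q) = inj₂ (trans x q)
      ... | inj₁ x | inj₂ (p , q) = inj₂ (trans x p)
      ... | inj₂ x | inj₂ (p , q) = inj₁ (trans x q)

      total : ∀ u v → adjacent u v ≡ true → _ ⊎ _
      total u v uv with end u v uv
      ... | inj₁ x = inj₁ λ uv′ → subst (λ e → α (proj₁ (edgeBetween u v e)) ≡ u) (uip uv uv′) x
      ... | inj₂ x = inj₂ λ vu → trans (cong α (same u v uv vu)) x

      respects : ∀ u L → Unique L →
        (∀ {v} → v ∈ₗ L → adjacent u v ≡ true × (∀ uv → α (proj₁ (edgeBetween u v uv)) ≡ u)) →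
        length L ≤ c u
      respects u [] _ _ = z≤n
      -- The empty list is treated apart because `capacity` applies to members of `C` only, and
      -- `u ∈ C` is deduced from an edge assigned to `u`.
      respects u L@(v₀ ∷ _) uL cov = begin
        length L
          ≡⟨ length-edgesTo L joined ⟨
        length (edgesTo L joined)
          ≤⟨ unique-length-≤ (edgesTo-unique uL joined) (λ e∈ →
               ∈-filter⁺ (λ e → α e Fin.≟ u) (∈-edges _) (owned L joined (λ v∈ → proj₂ (cov v∈)) e∈)) ⟩
        length (filter (λ e → α e Fin.≟ u) edges)
          ≤⟨ capacity u (subst (_∈ C) (proj₂ (cov (here refl)) (joined (here refl))) (α∈C _)) ⟩
        c u ∎
        where
        open ≤-Reasoning

        joined : ∀ {v} → v ∈ₗ L → adjacent u v ≡ true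
        joined v∈ = proj₁ (cov v∈)

        edgesTo : ∀ L → (∀ {v} → v ∈ₗ L → adjacent u v ≡ true) → List Edge
        edgesTo []      a = []
        edgesTo (v ∷ L) a = proj₁ (edgeBetween u v (a (here refl))) ∷ edgesTo L (λ v∈ → a (there v∈))

        length-edgesTo : ∀ L (a : ∀ {v} → v ∈ₗ L → adjacent u v ≡ true) → length (edgesTo L a) ≡ length L
        length-edgesTo []      a = refl
        length-edgesTo (v ∷ L) a = cong suc (length-edgesTo L (λ v∈ → a (there v∈)))

        owned : ∀ L (a : ∀ {v} → v ∈ₗ L → adjacent u v ≡ true) →
          (∀ {v} → v ∈ₗ L → ∀ uv → α (proj₁ (edgeBetween u v uv)) ≡ u) →
          ∀ {e} → e ∈ₗ edgesTo L a → α e ≡ u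
        owned (v ∷ L) a o (here refl) = o (here refl) _
        owned (v ∷ L) a o (there e∈)  = owned L (λ v∈ → a (there v∈)) (λ v∈ → o (there v∈)) e∈

        ∈-edgesTo⁻ : ∀ L (a : ∀ {v} → v ∈ₗ L → adjacent u v ≡ true) {e} → e ∈ₗ edgesTo L a →
          ∃[ v ] v ∈ₗ L × Σ[ uv ∈ adjacent u v ≡ true ] e ≡ proj₁ (edgeBetween u v uv)
        ∈-edgesTo⁻ (v ∷ L) a (here refl) = v , here refl , _ , refl
        ∈-edgesTo⁻ (v ∷ L) a (there e∈)  = let (w , w∈ , r) = ∈-edgesTo⁻ L (λ v∈ → a (there v∈)) e∈ in w , there w∈ , r

        edgeBetween-injective : ∀ {v w} uv uw → proj₁ (edgeBetween u v uv) ≡ proj₁ (edgeBetween u w uw) → v ≡ w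
        edgeBetween-injective {v} {w} uv uw eq with edgeBetween u v uv | edgeBetween u w uw
        edgeBetween-injective uv uw refl | e , inj₁ (refl , refl) | .e , inj₁ (refl , refl) = refl
        edgeBetween-injective uv uw refl | e , inj₁ (refl , refl) | .e , inj₂ (refl , refl) = refl
        edgeBetween-injective uv uw refl | e , inj₂ (refl , refl) | .e , inj₁ (refl , refl) = refl
        edgeBetween-injective uv uw refl | e , inj₂ (refl , refl) | .e , inj₂ (refl , refl) = refl

        edgesTo-unique : ∀ {L} → Unique L → (a : ∀ {v} → v ∈ₗ L → adjacent u v ≡ true) → Unique (edgesTo L a)
        edgesTo-unique []        a = []
        edgesTo-unique {v ∷ L} (v∉ ∷ uL) a = All.tabulate (λ e∈ eq →
            let (w , w∈ , uw , e≡) = ∈-edgesTo⁻ L (λ v∈ → a (there v∈)) e∈ in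
            All.lookup v∉ w∈ (edgeBetween-injective _ uw (trans eq e≡)))
          ∷ edgesTo-unique uL (λ v∈ → a (there v∈))

    -- If an edge is covered from both ends, `total` settles on one of them. The edges assigned to
    -- `w` are counted by their other ends, since an edge at `w` is determined by its other end.
    isCover : Covering adjacent c (_∈ C) → IsCapacitatedVertexCover G c C
    isCover covering = record
      { α        = α
      ; α∈C      = λ { e@(edge {u} {v} u<v uv) → α∈C e }
      ; incident = incident
      ; capacity = λ w _ → begin
          length (filter (λ e → α e Fin.≟ w) edges)
            ≡⟨ length-map (other w) (filter (λ e → α e Fin.≟ w) edges) ⟨
          length (map (other w) (filter (λ e → α e Fin.≟ w) edges))
            ≤⟨ respects w _ (map-unique (other w) (other-injective w) (Unique.filter⁺ _ edges-unique)) (owned w) ⟩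
          c w ∎
      }
      where
      open Covering covering
      open ≤-Reasoning

      α : Edge → Vertex
      α (edge {u} {v} _ uv) with total u v uv
      ... | inj₁ _ = u
      ... | inj₂ _ = v

      α∈C : ∀ e → α e ∈ C
      α∈C (edge {u} {v} _ uv) with total u v uv
      ... | inj₁ x = chosen uv x
      ... | inj₂ x = chosen (trans (symmetric v u) uv) x

      incident : ∀ e → α e ≡ Edge.u e ⊎ α e ≡ Edge.v e
      incident (edge {u} {v} _ uv) with total u v uv
      ... | inj₁ _ = inj₁ refl
      ... | inj₂ _ = inj₂ refl

      other : Vertex → Edge → Vertex
      other w (edge {u} {v} _ _) with u Fin.≟ w
      ... | yes _ = v
      ... | no  _ = u

      other-covered : ∀ w e → α e ≡ w → adjacent w (other w e) ≡ true × w covers other w e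
      other-covered w (edge {u} {v} u<v uv) α≡ with total u v uv | u Fin.≟ w
      ... | inj₁ x | yes refl = uv , x
      ... | inj₁ x | no  u≢w  = contradiction α≡ u≢w
      other-covered w (edge {u} {v} u<v uv) refl | inj₂ x | yes refl = ⊥-elim (Fin.<-irrefl refl u<v)
      other-covered w (edge {u} {v} u<v uv) refl | inj₂ x | no  _    = trans (symmetric v u) uv , x

      owned : ∀ w {x} → x ∈ₗ map (other w) (filter (λ e → α e Fin.≟ w) edges) →
              adjacent w x ≡ true × w covers x
      owned w x∈ = let (e , e∈ , x≡) = ∈-map⁻ (other w) x∈ in
        subst (λ x → adjacent w x ≡ true × w covers x) (sym x≡)
          (other-covered w e (proj₂ (∈-filter⁻ (λ e → α e Fin.≟ w) {xs = edges} e∈)))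

      ends : ∀ w e → α e ≡ w → Edge.u e ≡ w × Edge.v e ≡ other w e ⊎ Edge.u e ≡ other w e × Edge.v e ≡ w
      ends w e@(edge {u} {v} u<v uv) α≡ with incident e | u Fin.≟ w
      ... | inj₁ x | yes refl = inj₁ (refl , refl)
      ... | inj₁ x | no  u≢w  = contradiction (trans (sym x) α≡) u≢w
      ... | inj₂ x | yes refl = inj₁ (refl , refl)
      ... | inj₂ x | no  _    = inj₂ (refl , trans (sym x) α≡)

      other-injective : ∀ w {e f} → e ∈ₗ filter (λ e → α e Fin.≟ w) edges →
        f ∈ₗ filter (λ e → α e Fin.≟ w) edges → other w e ≡ other w f → e ≡ f
      other-injective w {e} {f} e∈ f∈ eq
        with ends w e (proj₂ (∈-filter⁻ (λ e → α e Fin.≟ w) {xs = edges} e∈))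
           | ends w f (proj₂ (∈-filter⁻ (λ e → α e Fin.≟ w) {xs = edges} f∈))
      ... | inj₁ (p , q) | inj₁ (p′ , q′) = edge-≡ (trans p (sym p′)) (trans q (trans eq (sym q′)))
      ... | inj₁ (p , q) | inj₂ (p′ , q′) = ⊥-elim (edge-≡′ {e} {f} (trans p (sym q′)) (trans q (trans eq (sym p′))))
      ... | inj₂ (p , q) | inj₁ (p′ , q′) = ⊥-elim (edge-≡′ {e} {f} (trans p (trans eq (sym q′))) (trans q (sym p′)))
      ... | inj₂ (p , q) | inj₂ (p′ , q′) = edge-≡ (trans p (trans eq (sym p′))) (trans q (sym q′))

-- Coverings restrict along embeddings. Both `number` and `vertex` are embeddings, so the
-- combinatorics can be done on `Node` instead of on numbers.
transport : ∀ {V W : Set} {adj : V → V → Bool} {adj′ : W → W → Bool} {cap : V → ℕ} {cap′ : W → ℕ}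
  {C : V → Set} {C′ : W → Set} (f : W → V) → (∀ {x y} → f x ≡ f y → x ≡ y) →
  (∀ x y → adj (f x) (f y) ≡ adj′ x y) → (∀ x → cap (f x) ≡ cap′ x) → (∀ {x} → C (f x) → C′ x) →
  Covering adj cap C → Covering adj′ cap′ C′
transport {adj = adj} f injective adj≡ cap≡ C⊆ covering = record
  { _covers_ = λ x y → f x covers f y
  ; total    = λ x y xy → total (f x) (f y) (trans (adj≡ x y) xy)
  ; chosen   = λ {x} {y} xy cov → C⊆ (chosen (trans (adj≡ x y) xy) cov)
  ; respects   = λ x L u cov → subst₂ _≤_ (length-map f L) (cap≡ x)
      (respects (f x) (map f L) (Unique.map⁺ injective u)
        λ v∈ → let (y , y∈ , v≡) = ∈-map⁻ f v∈
                   (xy , c)      = cov y∈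
               in subst (λ v → adj (f x) v ≡ true × f x covers v) (sym v≡) (trans (adj≡ x y) xy , c))
  }
  where open Covering covering

-- The graph of a hypergraph

-- A path vertex at position 1 + v stands for v; positions 0 and 1 + n are
-- the ends.
data Node (m n : ℕ) : Set where
  leaf path : Fin m → Fin (2 + n) → Node m n
  elem      : Fin n → Node m n

data Kind : Set where
  end miss hit : Kind

isHit : Kind → Bool
isHit hit = true
isHit _   = false

kindOf : Bool → Kind
kindOf false = miss
kindOf true  = hit

-- The values are 1, 2 and 3: the leaf; the leaf and one path edge; the leaf, the elem and one path
-- edge.
kindCapacity : Kind → ℕᵇ
kindCapacity end  = 1+[2 ℕᵇ.zero ]
kindCapacity miss = 2[1+ ℕᵇ.zero ]
kindCapacity hit  = 1+[2 1+[2 ℕᵇ.zero ] ]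

kindsThenEnd : ∀ {n} → Vec Bool n → Vec Kind (suc n)
kindsThenEnd []       = end ∷ []
kindsThenEnd (b ∷ bs) = kindOf b ∷ kindsThenEnd bs

kinds : ∀ {n} → Vec Bool n → Vec Kind (2 + n)
kinds bs = end ∷ kindsThenEnd bs

kindsThenEnd-hit : ∀ {n} (bs : Vec Bool n) (p : Fin (suc n)) (v : Fin n) → toℕ p ≡ toℕ v →
  lookup (kindsThenEnd bs) p ≡ kindOf (lookup bs v)
kindsThenEnd-hit (b ∷ bs) zero    zero    eq = refl
kindsThenEnd-hit (b ∷ bs) (suc p) (suc v) eq = kindsThenEnd-hit bs p v (suc-injective eq)

kindsThenEnd-end : ∀ {n} (bs : Vec Bool n) (p : Fin (suc n)) →
  lookup (kindsThenEnd bs) p ≡ end → toℕ p ≡ n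
kindsThenEnd-end []           zero    eq = refl
kindsThenEnd-end (true  ∷ bs) zero    ()
kindsThenEnd-end (false ∷ bs) zero    ()
kindsThenEnd-end (b ∷ bs)     (suc p) eq = cong suc (kindsThenEnd-end bs p eq)

kindsThenEnd-last : ∀ {n} (bs : Vec Bool n) → lookup (kindsThenEnd bs) (fromℕ n) ≡ end
kindsThenEnd-last []       = refl
kindsThenEnd-last (b ∷ bs) = kindsThenEnd-last bs

kindsThenEnd-elem : ∀ {n} (bs : Vec Bool n) (p : Fin (suc n)) →
  lookup (kindsThenEnd bs) p ≡ hit → ∃[ v ] toℕ p ≡ toℕ v × lookup bs v ≡ true
kindsThenEnd-elem (true ∷ bs) zero    eq = zero , refl , refl
kindsThenEnd-elem (b ∷ bs)    (suc p) eq =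
  let (v , p≡v , v∈) = kindsThenEnd-elem bs p eq in suc v , cong suc p≡v , v∈

-- 2 ^ k ∸ 1, a number which is at least k and whose binary digits are
-- found without arithmetic.
ones : ℕ → ℕᵇ
ones zero    = ℕᵇ.zero
ones (suc k) = 1+[2 ones k ]

≤-ones : ∀ k → k ≤ ℕᵇ.toℕ (ones k)
≤-ones zero    = z≤n
≤-ones (suc k) = s≤s (≤-trans (≤-ones k) (m≤m+n _ _))

-- No slot holds two elements, so the slots picked for distinct elements are distinct and the
-- pigeonhole principle applies to them.
slots-≤ : ∀ {A B : Set} (_at_ : A → B → Set) → (∀ {x y s} → x at s → y at s → x ≡ y) →
  ∀ {L ys} → Unique L → (∀ {x} → x ∈ₗ L → ∃[ s ] s ∈ₗ ys × x at s) → length L ≤ length ys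
slots-≤ {B = B} _at_ injective {L} {ys} unique place =
  subst (_≤ length ys) (length-slots L place) (unique-length-≤ (slots-unique unique place) (slots⊆ L place))
  where
  Placement : List _ → Set
  Placement L = ∀ {x} → x ∈ₗ L → ∃[ s ] s ∈ₗ ys × x at s

  slots : ∀ L → Placement L → List B
  slots []      f = []
  slots (x ∷ L) f = proj₁ (f (here refl)) ∷ slots L (λ x∈ → f (there x∈))

  length-slots : ∀ L (f : Placement L) → length (slots L f) ≡ length L
  length-slots []      f = refl
  length-slots (x ∷ L) f = cong suc (length-slots L (λ x∈ → f (there x∈)))

  slots⊆ : ∀ L (f : Placement L) {s} → s ∈ₗ slots L f → s ∈ₗ ys
  slots⊆ (x ∷ L) f (here refl) = proj₁ (proj₂ (f (here refl)))
  slots⊆ (x ∷ L) f (there s∈)  = slots⊆ L (λ x∈ → f (there x∈)) s∈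

  owner : ∀ L (f : Placement L) {s} → s ∈ₗ slots L f → ∃[ x ] x ∈ₗ L × x at s
  owner (x ∷ L) f (here refl) = x , here refl , proj₂ (proj₂ (f (here refl)))
  owner (x ∷ L) f (there s∈)  = let (y , y∈ , at) = owner L (λ x∈ → f (there x∈)) s∈ in y , there y∈ , at

  slots-unique : ∀ {L} → Unique L → (f : Placement L) → Unique (slots L f)
  slots-unique []               f = []
  slots-unique {x ∷ L} (x∉ ∷ u) f =
    All.tabulate (λ s∈ eq → let (y , y∈ , at) = owner L (λ x∈ → f (there x∈)) s∈ in
      All.lookup x∉ y∈ (injective (proj₂ (proj₂ (f (here refl)))) (subst (y at_) (sym eq) at)))
    ∷ slots-unique u (λ x∈ → f (there x∈))

parity : ℕ → Bool
parity zero    = false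
parity (suc k) = not (parity k)

-- The roles that a neighbour of a path vertex can have. Each is taken at most once, so a set of
-- neighbours is measured by a list of roles.
data Slot : Set where
  ofLeaf ofElem before after : Slot

module _ (H : Hypergraph) where
  open Hypergraph H renaming (order to n)

  m : ℕ
  m = length hyperedges

  Vertex : Set
  Vertex = Node m n

  hyperedge : Fin m → Subset n
  hyperedge = List.lookup hyperedges

  kind : Fin m → Fin (2 + n) → Kind
  kind e = lookup (kinds (hyperedge e))

  arc : Vertex → Vertex → Bool
  arc (leaf e p) (path f q) = (toℕ e ≡ᵇ toℕ f) ∧ (toℕ p ≡ᵇ toℕ q)
  arc (path e p) (path f q) = (toℕ e ≡ᵇ toℕ f) ∧ (suc (toℕ p) ≡ᵇ toℕ q)
  arc (path e p) (elem v)   = isHit (kind e p) ∧ (toℕ p ≡ᵇ suc (toℕ v))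
  arc _          _          = false

  adj : Vertex → Vertex → Bool
  adj x y = arc x y ∨ arc y x

  data Arc : Vertex → Vertex → Set where
    pendant : ∀ {e p} → Arc (leaf e p) (path e p)
    consecutive   : ∀ {e p q} → toℕ q ≡ suc (toℕ p) → Arc (path e p) (path e q)
    across  : ∀ {e p v} → kind e p ≡ hit → toℕ p ≡ suc (toℕ v) → Arc (path e p) (elem v)

  Neighbour : Vertex → Vertex → Set
  Neighbour x y = Arc x y ⊎ Arc y x

  private
    ≡ᵇ-true : ∀ {k l} → k ≡ l → (k ≡ᵇ l) ≡ true
    ≡ᵇ-true {k} {l} eq = Equivalence.to Bool.T-≡ (≡⇒≡ᵇ k l eq)

    ≡ᵇ-sound : ∀ k l → (k ≡ᵇ l) ≡ true → k ≡ l
    ≡ᵇ-sound k l eq = ≡ᵇ⇒≡ k l (Equivalence.from Bool.T-≡ eq)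

    ∧-true : ∀ {b c} → b ∧ c ≡ true → b ≡ true × c ≡ true
    ∧-true {true} {true} _ = refl , refl

  arc-sound : ∀ x y → arc x y ≡ true → Arc x y
  arc-sound (leaf e p) (path f q) eq with ∧-true {toℕ e ≡ᵇ toℕ f} eq
  ... | a , b with Fin.toℕ-injective (≡ᵇ-sound (toℕ e) (toℕ f) a) | Fin.toℕ-injective (≡ᵇ-sound (toℕ p) (toℕ q) b)
  ... | refl | refl = pendant
  arc-sound (path e p) (path f q) eq with ∧-true {toℕ e ≡ᵇ toℕ f} eq
  ... | a , b with Fin.toℕ-injective (≡ᵇ-sound (toℕ e) (toℕ f) a)
  ... | refl = consecutive (sym (≡ᵇ-sound (suc (toℕ p)) (toℕ q) b))
  arc-sound (path e p) (elem v)   eq with kind e p in k | ∧-true {isHit (kind e p)} eq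
  ... | hit | a , b = across k (≡ᵇ-sound (toℕ p) (suc (toℕ v)) b)

  arc-complete : ∀ {x y} → Arc x y → arc x y ≡ true
  arc-complete (pendant {e} {p})   = cong₂ _∧_ (≡ᵇ-true {toℕ e} refl) (≡ᵇ-true {toℕ p} refl)
  arc-complete (consecutive {e} eq)      = cong₂ _∧_ (≡ᵇ-true {toℕ e} refl) (≡ᵇ-true (sym eq))
  arc-complete (across k eq)       = cong₂ _∧_ (cong isHit k) (≡ᵇ-true eq)

  adj-sound : ∀ {x y} → adj x y ≡ true → Neighbour x y
  adj-sound {x} {y} eq with arc x y in a | arc y x in b
  ... | true  | _    = inj₁ (arc-sound x y a)
  ... | false | true = inj₂ (arc-sound y x b)

  adj-complete : ∀ {x y} → Neighbour x y → adj x y ≡ true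
  adj-complete {x} {y} (inj₁ a) rewrite arc-complete a = refl
  adj-complete {x} {y} (inj₂ a) rewrite arc-complete a = Bool.∨-zeroʳ (arc x y)

  ¬neighbour-self : ∀ {x} → ¬ Neighbour x x
  ¬neighbour-self (inj₁ (consecutive eq)) = 1+n≢n (sym eq)
  ¬neighbour-self (inj₂ (consecutive eq)) = 1+n≢n (sym eq)

  position : Vertex → ℕ
  position (leaf _ p) = toℕ p
  position (path _ p) = toℕ p
  position (elem v)   = toℕ v

  side : Vertex → Bool
  side (leaf e p) = not (parity (toℕ p))
  side (path e p) = parity (toℕ p)
  side (elem v)   = parity (toℕ v)

  arc-sides : ∀ {x y} → Arc x y → side x ≢ side y
  arc-sides pendant             eq = Bool.not-¬ refl (sym eq)
  arc-sides (consecutive {p = p} eq′) eq = Bool.not-¬ refl (trans eq (cong parity eq′))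
  arc-sides (across {v = v} _ eq′) eq = Bool.not-¬ refl (trans (sym eq) (cong parity eq′))

  neighbour-sides : ∀ {x y} → Neighbour x y → side x ≢ side y
  neighbour-sides (inj₁ a) = arc-sides a
  neighbour-sides (inj₂ a) = arc-sides a ∘ sym

  -- Leaves, paths, elems: every arc increases the number, so that the
  -- numbering is itself a degeneracy ordering.

  M : ℕ
  M = m * (2 + n)

  N : ℕ
  N = (M + M) + n

  number : Vertex → Fin N
  number (leaf e p) = (combine e p ↑ˡ M) ↑ˡ n
  number (path e p) = (M ↑ʳ combine e p) ↑ˡ n
  number (elem v)   = (M + M) ↑ʳ v

  vertex : Fin N → Vertex
  vertex i = [ [ uncurry leaf ∘ remQuot (2 + n) , uncurry path ∘ remQuot (2 + n) ]′ ∘ splitAt M , elem ]′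
    (splitAt (M + M) i)

  vertex-number : ∀ x → vertex (number x) ≡ x
  vertex-number (leaf e p)
    rewrite Fin.splitAt-↑ˡ (M + M) (combine e p ↑ˡ M) n | Fin.splitAt-↑ˡ M (combine e p) M = cong (uncurry leaf) (Fin.remQuot-combine {k = 2 + n} e p)
  vertex-number (path e p)
    rewrite Fin.splitAt-↑ˡ (M + M) (M ↑ʳ combine e p) n | Fin.splitAt-↑ʳ M M (combine e p) = cong (uncurry path) (Fin.remQuot-combine {k = 2 + n} e p)
  vertex-number (elem v) rewrite Fin.splitAt-↑ʳ (M + M) n v = refl

  number-vertex : ∀ i → number (vertex i) ≡ i
  number-vertex i with splitAt (M + M) i in eq
  ... | inj₂ v = Fin.splitAt⁻¹-↑ʳ eq
  ... | inj₁ j with splitAt M j in eq′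
  ... | inj₁ k = trans (cong (λ k → (k ↑ˡ M) ↑ˡ n) (Fin.combine-remQuot {m} (2 + n) k))
                   (trans (cong (_↑ˡ n) (Fin.splitAt⁻¹-↑ˡ eq′)) (Fin.splitAt⁻¹-↑ˡ eq))
  ... | inj₂ k = trans (cong (λ k → (M ↑ʳ k) ↑ˡ n) (Fin.combine-remQuot {m} (2 + n) k))
                   (trans (cong (_↑ˡ n) (Fin.splitAt⁻¹-↑ʳ eq′)) (Fin.splitAt⁻¹-↑ˡ eq))

  number-injective : ∀ {x y} → number x ≡ number y → x ≡ y
  number-injective {x} {y} eq = trans (sym (vertex-number x)) (trans (cong vertex eq) (vertex-number y))

  vertex-injective : ∀ {i j} → vertex i ≡ vertex j → i ≡ j
  vertex-injective {i} {j} eq = trans (sym (number-vertex i)) (trans (cong number eq) (number-vertex j))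

  number-increasing : ∀ {x y} → Arc x y → toℕ (number x) < toℕ (number y)
  number-increasing (pendant {e} {p})
    rewrite Fin.toℕ-↑ˡ (combine e p ↑ˡ M) n | Fin.toℕ-↑ˡ (combine e p) M
          | Fin.toℕ-↑ˡ (M ↑ʳ combine e p) n | Fin.toℕ-↑ʳ M (combine e p) =
    <-≤-trans (Fin.toℕ<n (combine e p)) (m≤m+n M _)
  number-increasing (consecutive {e} {p} {q} eq)
    rewrite Fin.toℕ-↑ˡ (M ↑ʳ combine e p) n | Fin.toℕ-↑ʳ M (combine e p) | Fin.toℕ-combine e p
          | Fin.toℕ-↑ˡ (M ↑ʳ combine e q) n | Fin.toℕ-↑ʳ M (combine e q) | Fin.toℕ-combine e q | eq =
    +-monoʳ-< M (+-monoʳ-< ((2 + n) * toℕ e) ≤-refl)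
  number-increasing (across {e} {p} {v} _ _)
    rewrite Fin.toℕ-↑ˡ (M ↑ʳ combine e p) n | Fin.toℕ-↑ʳ (M + M) v =
    <-≤-trans (Fin.toℕ<n (M ↑ʳ combine e p)) (m≤m+n (M + M) _)

  graph : Graph
  graph = record
    { order       = N
    ; adjacent    = λ i j → adj (vertex i) (vertex j)
    ; symmetric   = λ i j → Bool.∨-comm (arc (vertex i) (vertex j)) (arc (vertex j) (vertex i))
    ; irreflexive = λ i → Bool.¬-not (¬neighbour-self ∘ adj-sound {vertex i})
    }

  capacity : Vertex → ℕᵇ
  capacity (leaf e p) = ℕᵇ.zero
  capacity (path e p) = kindCapacity (kind e p)
  capacity (elem v)   = ones N

  bipartite : Graph.Bipartite graph
  bipartite = side ∘ vertex , λ i j eq → neighbour-sides (adj-sound {vertex i} eq)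

  data At (e : Fin m) (p : Fin (2 + n)) : Vertex → Slot → Set where
    leaf   : At e p (leaf e p) ofLeaf
    elem   : ∀ {v} → kind e p ≡ hit → toℕ p ≡ suc (toℕ v) → At e p (elem v) ofElem
    before : ∀ {q} → toℕ p ≡ suc (toℕ q) → At e p (path e q) before
    after  : ∀ {q} → toℕ q ≡ suc (toℕ p) → At e p (path e q) after

  at-injective : ∀ {e p x y s} → At e p x s → At e p y s → x ≡ y
  at-injective leaf       leaf       = refl
  at-injective (elem _ a) (elem _ b) = cong elem (Fin.toℕ-injective (suc-injective (trans (sym a) b)))
  at-injective (before a) (before b) = cong (path _) (Fin.toℕ-injective (suc-injective (trans (sym a) b)))
  at-injective (after a)  (after b)  = cong (path _) (Fin.toℕ-injective (trans a (sym b)))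

  slotOf : ∀ {e p x} → Neighbour (path e p) x → ∃[ s ] At e p x s
  slotOf (inj₁ (consecutive a))    = after , after a
  slotOf (inj₁ (across k a)) = ofElem , elem k a
  slotOf (inj₂ pendant)      = ofLeaf , leaf
  slotOf (inj₂ (consecutive a))    = before , before a

  -- Along arcs a leaf sees its path vertex, a path vertex sees its successor and its elem, and an
  -- elem sees nothing. This is where degeneracy 2 comes from.
  arcs-≤-2 : ∀ x L → Unique L → (∀ {y} → y ∈ₗ L → Arc x y) → length L ≤ 2
  arcs-≤-2 (leaf e p) L u arcs = ≤-trans (unique-length-≤ {ys = path e p ∷ []} u (only ∘ arcs)) (s≤s z≤n)
    where
    only : ∀ {y} → Arc (leaf e p) y → y ∈ₗ path e p ∷ []
    only pendant = here refl
  arcs-≤-2 (path e p) L u arcs =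
    slots-≤ (At e p) at-injective {ys = after ∷ ofElem ∷ []} u (slots ∘ arcs)
    where
    slots : ∀ {y} → Arc (path e p) y → ∃[ s ] s ∈ₗ after ∷ ofElem ∷ [] × At e p y s
    slots (consecutive a)    = after , here refl , after a
    slots (across k a) = ofElem , there (here refl) , elem k a
  arcs-≤-2 (elem v) []      u arcs = z≤n
  arcs-≤-2 (elem v) (y ∷ L) u arcs with () ← arcs (here refl)

  degenerate : Graph.Degenerate graph 2
  degenerate = Permutation.id , λ i →
    let later         = Graph.neighbours graph i ∩ Graph.suffix graph Permutation.id i
        (L , u , L⊆ , len) = elements later
    in subst (_≤ 2) (trans (length-map vertex L) len)
         (arcs-≤-2 (vertex i) (map vertex L) (Unique.map⁺ vertex-injective u) (arcs i L L⊆))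
    where
    tabulated : ∀ {k} (f : Fin k → Bool) {i} → i ∈ Vec.tabulate f → f i ≡ true
    tabulated f {i} i∈ = trans (sym (lookup∘tabulate f i)) ([]=⇒lookup i∈)

    later-arc : ∀ i j → j ∈ Graph.neighbours graph i ∩ Graph.suffix graph Permutation.id i →
                Arc (vertex i) (vertex j)
    later-arc i j j∈ with x∈p∩q⁻ (Graph.neighbours graph i) (Graph.suffix graph Permutation.id i) j∈
    ... | nb , later with adj-sound {vertex i} (tabulated (λ j → adj (vertex i) (vertex j)) nb)
    ... | inj₁ a = a
    ... | inj₂ a = contradiction
      (subst₂ (λ i j → toℕ j < toℕ i) (number-vertex i) (number-vertex j) (number-increasing a))
      (≤⇒≯ (≤ᵇ⇒≤ (toℕ i) (toℕ j) (Equivalence.from Bool.T-≡ (tabulated (λ v → does (i Fin.≤? v)) later))))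

    arcs : ∀ i L → (∀ {j} → j ∈ₗ L → j ∈ _) → ∀ {y} → y ∈ₗ map vertex L → Arc (vertex i) y
    arcs i L L⊆ y∈ = let (j , j∈ , y≡) = ∈-map⁻ vertex y∈ in
      subst (Arc (vertex i)) (sym y≡) (later-arc i j (L⊆ j∈))

  cap : Vertex → ℕ
  cap x = ℕᵇ.toℕ (capacity x)

  incidence : ∀ e p v → toℕ p ≡ suc (toℕ v) → kind e p ≡ kindOf (lookup (hyperedge e) v)
  incidence e (suc p) v eq = kindsThenEnd-hit (hyperedge e) p v (suc-injective eq)

  -- From covers to transversals

  module _ {C : Vertex → Set} (covering : Covering adj cap C) where
    open Covering covering

    private
      too-many : ∀ x L {k} → cap x ≡ k → k < length L → Unique L →
                 (∀ {y} → y ∈ₗ L → Neighbour x y × x covers y) → ⊥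
      too-many x L refl k< u cov =
        <⇒≱ k< (respects x L u λ y∈ → let (a , c) = cov y∈ in adj-complete a , c)

      total′ : ∀ {x y} → Neighbour x y → x covers y ⊎ y covers x
      total′ a = total _ _ (adj-complete a)

    path-covers-leaf : ∀ e p → path e p covers leaf e p
    path-covers-leaf e p with total′ (inj₁ (pendant {e} {p}))
    ... | inj₂ c = c
    ... | inj₁ c = ⊥-elim (too-many (leaf e p) (path e p ∷ []) refl (s≤s z≤n) ([] ∷ [])
                     λ { (here refl) → inj₁ pendant , c })

    path-chosen : ∀ e p → C (path e p)
    path-chosen e p = chosen (adj-complete (inj₂ (pendant {e} {p}))) (path-covers-leaf e p)

    path-covers-elem : ∀ {e p v} → ¬ C (elem v) → kind e p ≡ hit → toℕ p ≡ suc (toℕ v) →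
                       path e p covers elem v
    path-covers-elem ¬v k eq with total′ (inj₁ (across k eq))
    ... | inj₁ c = c
    ... | inj₂ c = contradiction (chosen (adj-complete (inj₂ (across k eq))) c) ¬v

    -- The capacity 1 of an end is spent on its leaf.
    end-covers-no-path : ∀ {e p x} → kind e p ≡ end → Neighbour (path e p) x → (∀ {f q} → x ≢ leaf f q) → ¬ path e p covers x
    end-covers-no-path {e} {p} {x} k a x≢ c =
      too-many (path e p) (leaf e p ∷ x ∷ []) (cong (ℕᵇ.toℕ ∘ kindCapacity) k) ≤-refl
        (((λ eq → x≢ (sym eq)) ∷ []) ∷ [] ∷ [])
        λ { (here refl) → inj₂ pendant , path-covers-leaf e p ; (there (here refl)) → a , c }

    -- The edges of the path of e exceed by one what the path vertices
    -- can cover besides their other edges, unless some vertex of e is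
    -- chosen: otherwise each path edge is covered by its later end.
    module _ (e : Fin m) (none : ∀ v → lookup (hyperedge e) v ≡ true → ¬ C (elem v)) where

      elem-at : ∀ p → kind e p ≡ hit → ∃[ v ] toℕ p ≡ suc (toℕ v) × ¬ C (elem v)
      elem-at (suc p) k = let (v , eq , v∈) = kindsThenEnd-elem (hyperedge e) p k in
        v , cong suc eq , none v v∈

      -- Here `p` indexes the path edges, the edge `p` joining positions `inject₁ p` and `suc p`.
      -- The first end has no room for a path edge. Inductively, a vertex that must cover the edge
      -- to its predecessor has no room for the edge to its successor: with the leaf, and the elem
      -- if there is one, that would exceed its capacity by one.
      forward : ∀ (p : Fin (suc n)) → ¬ path e (inject₁ p) covers path e (suc p)
      forward = <-weakInduction (λ p → ¬ path e (inject₁ p) covers path e (suc p))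
        (end-covers-no-path {e} {zero} refl (inj₁ (consecutive refl)) (λ ())) step
        where
        step : ∀ p → ¬ path e (inject₁ (inject₁ p)) covers path e (suc (inject₁ p)) →
               ¬ path e (inject₁ (suc p)) covers path e (suc (suc p))
        step p previous c = go (kind e q) refl
          where
          r = inject₁ (inject₁ p)
          q = suc (inject₁ p)
          s = suc (suc p)
          q≡1+r : toℕ q ≡ suc (toℕ r)
          q≡1+r = cong suc (sym (Fin.toℕ-inject₁ (inject₁ p)))
          s≡1+q : toℕ s ≡ suc (toℕ q)
          s≡1+q = cong (λ k → suc (suc k)) (sym (Fin.toℕ-inject₁ p))
          back : path e q covers path e r
          back with total′ (inj₁ (consecutive q≡1+r))
          ... | inj₂ c′ = c′
          ... | inj₁ c′ = contradiction c′ previous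
          r≢s : path e r ≢ path e s
          r≢s eq = <⇒≢ (<-trans (≤-reflexive (sym q≡1+r)) (≤-reflexive (sym s≡1+q))) (cong position eq)
          go : ∀ k → kind e q ≡ k → ⊥
          go end k = end-covers-no-path k (inj₁ (consecutive s≡1+q)) (λ ()) c
          go miss k = too-many (path e q) (leaf e q ∷ path e r ∷ path e s ∷ [])
            (cong (ℕᵇ.toℕ ∘ kindCapacity) k) ≤-refl
            (((λ ()) ∷ (λ ()) ∷ []) ∷ (r≢s ∷ []) ∷ [] ∷ [])
            λ { (here refl) → inj₂ pendant , path-covers-leaf e q
              ; (there (here refl)) → inj₂ (consecutive q≡1+r) , back
              ; (there (there (here refl))) → inj₁ (consecutive s≡1+q) , c }
          go hit k with elem-at q k
          ... | v , eq , ¬v = too-many (path e q) (leaf e q ∷ elem v ∷ path e r ∷ path e s ∷ [])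
            (cong (ℕᵇ.toℕ ∘ kindCapacity) k) ≤-refl
            (((λ ()) ∷ (λ ()) ∷ (λ ()) ∷ []) ∷ ((λ ()) ∷ (λ ()) ∷ []) ∷ (r≢s ∷ []) ∷ [] ∷ [])
            λ { (here refl) → inj₂ pendant , path-covers-leaf e q
              ; (there (here refl)) → inj₁ (across k eq) , path-covers-elem ¬v k eq
              ; (there (there (here refl))) → inj₂ (consecutive q≡1+r) , back
              ; (there (there (there (here refl)))) → inj₁ (consecutive s≡1+q) , c }

      not-covered : ⊥
      -- The last path edge is left over: `forward` excludes its earlier vertex, and its later one
      -- is an end.
      not-covered with total′ (inj₁ (consecutive {e} {inject₁ (fromℕ n)} {suc (fromℕ n)} (cong suc (sym (Fin.toℕ-inject₁ (fromℕ n))))))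
      ... | inj₁ c = forward (fromℕ n) c
      ... | inj₂ c = end-covers-no-path (kindsThenEnd-last (hyperedge e))
                       (inj₂ (consecutive (cong suc (sym (Fin.toℕ-inject₁ (fromℕ n)))))) (λ ()) c

  -- From transversals to covers

  InCover : Subset n → Vertex → Set
  InCover S (leaf _ _) = ⊥
  InCover S (path _ _) = ⊤
  InCover S (elem v)   = v ∈ S

  -- Every path edge is covered by its end nearer to the pivot, which thus
  -- covers both of its path edges, in exchange for the edge to a chosen
  -- vertex of e.
  module _ (S : Subset n) (transversal : ∀ e → ∃[ v ] v ∈ S × lookup (hyperedge e) v ≡ true) where

    pivot : Fin m → ℕ
    pivot e = suc (toℕ (proj₁ (transversal e)))

    -- The relation is consulted only for adjacent vertices, so the constructors leave the
    -- hyperedges of the two sides unrelated. Between path vertices only the direction of the step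
    -- and the side of the pivot decide.
    data _Covers_ : Vertex → Vertex → Set where
      pathLeaf : ∀ {e p f q} → path e p Covers leaf f q
      forwards : ∀ {e p f q} → toℕ p < toℕ q → pivot e ≤ toℕ p → path e p Covers path f q
      backwards : ∀ {e p f q} → toℕ q < toℕ p → toℕ p ≤ pivot e → path e p Covers path f q
      pathElem : ∀ {e p v} → v ∉ S → path e p Covers elem v
      elemPath : ∀ {e p v} → v ∈ S → elem v Covers path e p

    arc-total : ∀ {x y} → Arc x y → x Covers y ⊎ y Covers x
    arc-total pendant = inj₂ pathLeaf
    arc-total (consecutive {e} {p} {q} eq) with pivot e ≤? toℕ p
    ... | yes h≤p = inj₁ (forwards (≤-reflexive (sym eq)) h≤p)
    ... | no  h≰p = inj₂ (backwards (≤-reflexive (sym eq)) (subst (_≤ pivot e) (sym eq) (≰⇒> h≰p)))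
    arc-total (across {v = v} k eq) with v ∈? S
    ... | yes v∈ = inj₂ (elemPath v∈)
    ... | no  v∉ = inj₁ (pathElem v∉)

    covers-chosen : ∀ {x y} → x Covers y → InCover S x
    covers-chosen pathLeaf        = tt
    covers-chosen (forwards _ _)  = tt
    covers-chosen (backwards _ _) = tt
    covers-chosen (pathElem _)    = tt
    covers-chosen (elemPath v∈)   = v∈

    end-position : ∀ e p → kind e p ≡ end → toℕ p ≡ 0 ⊎ toℕ p ≡ suc n
    end-position e zero    k = inj₁ refl
    end-position e (suc p) k = inj₂ (cong suc (kindsThenEnd-end (hyperedge e) p k))

    pivot-hit : ∀ e p → toℕ p ≡ pivot e → kind e p ≡ hit
    pivot-hit e p eq = trans (incidence e p _ eq) (cong kindOf (proj₂ (proj₂ (transversal e))))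

    slotsOfKind : Kind → Slot → List Slot
    slotsOfKind end  s = ofLeaf ∷ []
    slotsOfKind miss s = ofLeaf ∷ s ∷ []
    slotsOfKind hit  s = ofLeaf ∷ s ∷ ofElem ∷ []

    length-slotsOfKind : ∀ k s → length (slotsOfKind k s) ≡ ℕᵇ.toℕ (kindCapacity k)
    length-slotsOfKind end  s = refl
    length-slotsOfKind miss s = refl
    length-slotsOfKind hit  s = refl

    second∈ : ∀ {k s} → k ≢ end → s ∈ₗ slotsOfKind k s
    second∈ {end}  k≢ = contradiction refl k≢
    second∈ {miss} k≢ = there (here refl)
    second∈ {hit}  k≢ = there (here refl)

    leaf∈ : ∀ k {s} → ofLeaf ∈ₗ slotsOfKind k s
    leaf∈ end  = here refl
    leaf∈ miss = here refl
    leaf∈ hit  = here refl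

    elem∈ : ∀ {k s} → k ≡ hit → ofElem ∈ₗ slotsOfKind k s
    elem∈ refl = there (there (here refl))

    -- Before the pivot a vertex covers backwards and after it forwards, so it spends a single path
    -- slot, and an end spends none because its only path edge lies towards the pivot. The pivot
    -- spends both path slots; its capacity 3 suffices because its elem is in `S` and covers their
    -- common edge.
    usedSlots : ∀ e p → Σ[ ss ∈ List Slot ] length ss ≡ cap (path e p) ×
      (∀ {x s} → At e p x s → path e p Covers x → s ∈ₗ ss)
    usedSlots e p with <-cmp (toℕ p) (pivot e)
    ... | tri< p<h _ _ = slotsOfKind (kind e p) before , length-slotsOfKind (kind e p) _ , used
      where
      not-end : ∀ {q : Fin (2 + n)} → toℕ p ≡ suc (toℕ q) → kind e p ≢ end
      not-end eq k with end-position e p k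
      ... | inj₁ p≡0 = 1+n≢0 (trans (sym eq) p≡0)
      ... | inj₂ p≡  = <-irrefl refl (<-≤-trans (subst (_< pivot e) p≡ p<h) (≤-trans (Fin.toℕ<n (proj₁ (transversal e))) (n≤1+n n)))
      used : ∀ {x s} → At e p x s → path e p Covers x → s ∈ₗ slotsOfKind (kind e p) before
      used leaf        _               = leaf∈ (kind e p)
      used (elem k _)  _               = elem∈ k
      used (before {q} a)  _           = second∈ (not-end {q} a)
      used (after a) (forwards _ h≤p)  = contradiction h≤p (<⇒≱ p<h)
      used (after a) (backwards q<p _) = contradiction (subst (_< toℕ p) a q<p) (<-asym (n<1+n _))
    ... | tri> _ _ h<p = slotsOfKind (kind e p) after , length-slotsOfKind (kind e p) _ , used
      where
      not-end : ∀ {q : Fin (2 + n)} → toℕ q ≡ suc (toℕ p) → kind e p ≢ end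
      not-end {q} eq k with end-position e p k
      ... | inj₁ p≡0 = <⇒≱ h<p (≤-trans (≤-reflexive p≡0) z≤n)
      ... | inj₂ p≡  = <-irrefl refl (subst (_< 2 + n) (trans eq (cong suc p≡)) (Fin.toℕ<n q))
      used : ∀ {x s} → At e p x s → path e p Covers x → s ∈ₗ slotsOfKind (kind e p) after
      used leaf        _               = leaf∈ (kind e p)
      used (elem k _)  _               = elem∈ k
      used (after {q} a) _             = second∈ (not-end {q} a)
      used (before a) (forwards p<q _) = contradiction (subst (_< _) a p<q) (<-asym (n<1+n _))
      used (before a) (backwards _ p≤h) = contradiction p≤h (<⇒≱ h<p)
    ... | tri≈ _ p≡h _ = ofLeaf ∷ before ∷ after ∷ [] ,
        sym (cong (ℕᵇ.toℕ ∘ kindCapacity) (pivot-hit e p p≡h)) , used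
      where
      used : ∀ {x s} → At e p x s → path e p Covers x → s ∈ₗ ofLeaf ∷ before ∷ after ∷ []
      used leaf       _ = here refl
      used (before _) _ = there (here refl)
      used (after _)  _ = there (there (here refl))
      used (elem k a) (pathElem v∉) = contradiction
        (subst (_∈ S) (Fin.toℕ-injective (suc-injective (trans (sym p≡h) a))) (proj₁ (proj₂ (transversal e)))) v∉

    within-capacity : ∀ x L → Unique L → (∀ {y} → y ∈ₗ L → adj x y ≡ true × x Covers y) → length L ≤ cap x
    within-capacity (leaf e p) []      u cov = z≤n
    within-capacity (leaf e p) (y ∷ L) u cov with () ← proj₂ (cov (here refl))
    -- The capacity of an elem is at least the number of all vertices, so its degree need not be
    -- known.
    within-capacity (elem v) L u cov = begin
      length L              ≡⟨ length-map number L ⟨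
      length (map number L) ≤⟨ unique-length-≤ (Unique.map⁺ number-injective u) (λ _ → ∈-allFin _) ⟩
      length (allFin N)     ≡⟨ length-tabulate id ⟩
      N                     ≤⟨ ≤-ones N ⟩
      ℕᵇ.toℕ (ones N)       ∎
      where open ≤-Reasoning
    within-capacity (path e p) L u cov =
      let (ss , len , used) = usedSlots e p in
      subst (length L ≤_) len (slots-≤ (At e p) at-injective u λ {y} y∈ →
        let (a , c) = cov y∈
            (s , at) = slotOf (adj-sound {path e p} {y} a)
        in s , used at c , at)

    transversal-covering : Covering adj cap (InCover S)
    transversal-covering = record
      { _covers_ = _Covers_
      ; total    = λ x y a → [ arc-total , swap ∘ arc-total ]′ (adj-sound a)
      ; chosen   = λ _ → covers-chosen
      ; respects   = within-capacity
      }

-- Minimal covers and minimal transversals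

∈-tabulate⁺ : ∀ {n} (f : Fin n → Bool) {i} → f i ≡ true → i ∈ Vec.tabulate f
∈-tabulate⁺ f {i} eq = lookup⇒[]= i (Vec.tabulate f) (trans (lookup∘tabulate f i) eq)

∈-tabulate⁻ : ∀ {n} (f : Fin n → Bool) {i} → i ∈ Vec.tabulate f → f i ≡ true
∈-tabulate⁻ f {i} i∈ = trans (sym (lookup∘tabulate f i)) ([]=⇒lookup i∈)

⊆∧⊄⇒≡ : ∀ {n} {p q : Subset n} → p ⊆ q → ¬ (p ⊂ q) → p ≡ q
⊆∧⊄⇒≡ {p = p} {q} p⊆q p⊄q = ⊆-antisym p⊆q λ {x} x∈q →
  decidable-stable (x ∈? p) λ x∉p → p⊄q (p⊆q , x , x∈q , x∉p)

module _ (H : Hypergraph) where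
  open Hypergraph H renaming (order to n)

  inCover : Subset n → Vertex H → Bool
  inCover S (leaf _ _) = false
  inCover S (path _ _) = true
  inCover S (elem v)   = lookup S v

  extend : Subset n → Subset (N H)
  extend S = Vec.tabulate (inCover S ∘ vertex H)

  restrict : Subset (N H) → Subset n
  restrict C = Vec.tabulate λ v → lookup C ((M H + M H) ↑ʳ v)

  IsCover : Subset (N H) → Set
  IsCover = IsCapacitatedVertexCover (graph H) (cap H ∘ vertex H)

  ∈-restrict⁺ : ∀ {C v} → number H (elem v) ∈ C → v ∈ restrict C
  ∈-restrict⁺ v∈ = ∈-tabulate⁺ _ ([]=⇒lookup v∈)

  ∈-restrict⁻ : ∀ {C v} → v ∈ restrict C → number H (elem v) ∈ C
  ∈-restrict⁻ {C} v∈ = lookup⇒[]= _ C (∈-tabulate⁻ _ v∈)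

  ∈-extend⁺ : ∀ {S} x → InCover H S x → number H x ∈ extend S
  ∈-extend⁺ {S} x x∈ = ∈-tabulate⁺ _ (trans (cong (inCover S) (vertex-number H x)) (go x x∈))
    where
    go : ∀ x → InCover H S x → inCover S x ≡ true
    go (path _ _) _  = refl
    go (elem v)   v∈ = []=⇒lookup v∈

  ∈-extend⁻ : ∀ {S} i → i ∈ extend S → InCover H S (vertex H i)
  ∈-extend⁻ {S} i i∈ = go (vertex H i) (∈-tabulate⁻ (inCover S ∘ vertex H) i∈)
    where
    go : ∀ x → inCover S x ≡ true → InCover H S x
    go (path _ _) _  = tt
    go (elem v)   eq = lookup⇒[]= v S eq

  restrict-extend : ∀ S → restrict (extend S) ≡ S
  restrict-extend S = trans
    (Vec.tabulate-cong λ v → trans (lookup∘tabulate (inCover S ∘ vertex H) _) (cong (inCover S) (vertex-number H (elem v))))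
    (tabulate∘lookup S)

  module _ {C} (cover : IsCover C) where

    private
      covered : Covering (adj H) (cap H) (λ x → number H x ∈ C)
      covered = transport (number H) (number-injective H)
        (λ x y → cong₂ (adj H) (vertex-number H x) (vertex-number H y))
        (λ x → cong (cap H) (vertex-number H x)) id (covering (graph H) _ cover)

    paths⊆cover : ∀ e p → number H (path e p) ∈ C
    paths⊆cover = path-chosen H covered

    -- The counting argument refutes that `e` is missed; as nonemptiness of a subset is decidable,
    -- this yields an actual common element.
    restrict-transversal : IsTransversal H (restrict C)
    restrict-transversal {e} e∈ = decidable-stable (nonempty? (restrict C ∩ e)) λ empty →
      not-covered H covered (index e∈) λ v v∈e v∈C →
        empty (v , x∈p∩q⁺ (∈-restrict⁺ v∈C ,
          lookup⇒[]= v e (trans (cong (λ e → lookup e v) (lookup-index e∈)) v∈e)))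

  extend-cover : ∀ {S} → IsTransversal H S → IsCover (extend S)
  extend-cover {S} transversal = isCover (graph H) _
    (transport (vertex H) (vertex-injective H) (λ _ _ → refl) (λ _ → refl)
      (λ {i} x∈ → subst (_∈ extend S) (number-vertex H i) (∈-extend⁺ (vertex H i) x∈))
      (transversal-covering H S λ e →
        let (v , v∈) = transversal (∈-lookup e)
            (v∈S , v∈e) = x∈p∩q⁻ S (hyperedge H e) v∈
        in v , v∈S , []=⇒lookup v∈e))

  -- Every cover contains all path vertices, so only the elems remain to be compared.
  extend-⊆ : ∀ {S C} → IsCover C → S ⊆ restrict C → extend S ⊆ C
  extend-⊆ {S} {C} cover S⊆ {i} i∈ = subst (_∈ C) (number-vertex H i) (go (vertex H i) (∈-extend⁻ i i∈))
    where
    go : ∀ x → InCover H S x → number H x ∈ C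
    go (path e p) _  = paths⊆cover cover e p
    go (elem v)   v∈ = ∈-restrict⁻ (S⊆ v∈)

  -- The left side is itself a cover inside `C`, so minimality forces equality. In particular a
  -- minimal cover contains no leaves.
  extend-restrict : ∀ {C} → Minimal IsCover C → extend (restrict C) ≡ C
  extend-restrict (cover , minimal) =
    ⊆∧⊄⇒≡ (extend-⊆ cover id) λ lt → minimal lt (extend-cover (restrict-transversal cover))

  restrict-minimal : ∀ {C} → Minimal IsCover C → Minimal (IsTransversal H) (restrict C)
  restrict-minimal {C} (cover , minimal) = restrict-transversal cover ,
    λ {R} (R⊆ , v , v∈ , v∉) transversal → minimal
      (extend-⊆ cover R⊆ , number H (elem v) , ∈-restrict⁻ v∈ ,
        λ v∈′ → v∉ (subst (InCover H R) (vertex-number H (elem v)) (∈-extend⁻ _ v∈′)))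
      (extend-cover transversal)

  extend-minimal : ∀ {S} → Minimal (IsTransversal H) S → Minimal IsCover (extend S)
  extend-minimal {S} (transversal , minimal) = extend-cover transversal ,
    λ {R} (R⊆ , i , i∈ , i∉) cover → minimal
      (restrict-⊆ R⊆ , strict R i i∈ i∉ cover) (restrict-transversal cover)
    where
    restrict-⊆ : ∀ {R} → R ⊆ extend S → restrict R ⊆ S
    restrict-⊆ R⊆ {v} v∈ = subst (InCover H S) (vertex-number H (elem v)) (∈-extend⁻ _ (R⊆ (∈-restrict⁻ v∈)))

    -- The vertex that `R` lacks must be an elem: `R`, being a cover, contains the path vertices,
    -- and `extend S` contains no leaves.
    strict : ∀ R i → i ∈ extend S → i ∉ R → IsCover R → ∃[ v ] v ∈ S × v ∉ restrict R
    strict R i i∈ i∉ cover = go (vertex H i) (∈-extend⁻ i i∈) (i∉ ∘ subst (_∈ R) (number-vertex H i))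
      where
      go : ∀ x → InCover H S x → number H x ∉ R → ∃[ v ] v ∈ S × v ∉ restrict R
      go (path e p) _  x∉ = contradiction (paths⊆cover cover e p) x∉
      go (elem v)   v∈ x∉ = v , v∈ , x∉ ∘ ∈-restrict⁻

-- Lists and their encodings

encodeList-map : ∀ {A B : Set} (enc : B → Tree) (f : A → B) xs →
                 encodeList enc (map f xs) ≡ encodeList (enc ∘ f) xs
encodeList-map enc f []       = refl
encodeList-map enc f (x ∷ xs) = cong (enc (f x) ∙_) (encodeList-map enc f xs)

encodeList-cong : ∀ {A : Set} {f g : A → Tree} → (∀ x → f x ≡ g x) → ∀ xs → encodeList f xs ≡ encodeList g xs
encodeList-cong f≗g []       = refl
encodeList-cong f≗g (x ∷ xs) = cong₂ _∙_ (f≗g x) (encodeList-cong f≗g xs)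

encodeList-tabulate : ∀ {A : Set} {n} (enc : A → Tree) (f : Fin n → A) →
                      encodeList enc (tabulate f) ≡ encodeList (enc ∘ f) (allFin n)
encodeList-tabulate enc f = trans (cong (encodeList enc) (sym (map-tabulate id f))) (encodeList-map enc f _)

toList-lookup : ∀ {A : Set} {n} (xs : Vec A n) → toList xs ≡ tabulate (lookup xs)
toList-lookup []       = refl
toList-lookup (x ∷ xs) = cong (x ∷_) (toList-lookup xs)

toList-tabulate : ∀ {A : Set} {n} (f : Fin n → A) → toList (Vec.tabulate f) ≡ tabulate f
toList-tabulate {n = zero}  f = refl
toList-tabulate {n = suc n} f = cong (f zero ∷_) (toList-tabulate (f ∘ suc))

tabulate-+ : ∀ {A : Set} k {l} (f : Fin (k + l) → A) →
             tabulate f ≡ tabulate (λ i → f (i ↑ˡ l)) ++ tabulate (λ j → f (k ↑ʳ j))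
tabulate-+ zero    f = refl
tabulate-+ (suc k) f = cong (f zero ∷_) (tabulate-+ k (f ∘ suc))

tabulate-* : ∀ {A : Set} k {l} (f : Fin (k * l) → A) →
             tabulate f ≡ concatMap (λ i → tabulate (λ j → f (combine i j))) (allFin k)
tabulate-* zero    f = refl
tabulate-* (suc k) {l} f = trans (tabulate-+ l f) (cong (tabulate (λ j → f (j ↑ˡ k * l)) ++_)
  (trans (tabulate-* k (λ i → f (l ↑ʳ i)))
    (cong List.concat (trans (map-tabulate id (block ∘ suc)) (sym (map-tabulate suc block))))))
  where
  block : Fin (suc k) → List _
  block i = tabulate (λ j → f (combine i j))

numbered-tabulate : ∀ {A : Set} {n} k (f : Fin n → A) →
                    numbered k (tabulate f) ≡ tabulate (λ i → k + toℕ i , f i)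
numbered-tabulate {n = zero}  k f = refl
numbered-tabulate {n = suc n} k f = cong₂ _∷_ (cong (_, f zero) (sym (+-identityʳ k)))
  (trans (numbered-tabulate (suc k) (f ∘ suc)) (tabulate-cong λ i → cong (_, f (suc i)) (sym (+-suc k (toℕ i)))))

dropTree-++ : ∀ {A : Set} (enc : A → Tree) xs ys →
              dropTree (length xs) (encodeList enc (xs ++ ys)) ≡ encodeList enc ys
dropTree-++ enc []       ys = refl
dropTree-++ enc (x ∷ xs) ys = dropTree-++ enc xs ys

length-≤-size : ∀ {A : Set} (enc : A → Tree) xs → length xs ≤ size (encodeList enc xs)
length-≤-size enc []       = z≤n
length-≤-size enc (x ∷ xs) = s≤s (≤-trans (length-≤-size enc xs) (m≤n+m _ (size (enc x))))

size-encodeList-≤ : ∀ {A : Set} (enc : A → Tree) {b} → (∀ x → size (enc x) ≤ b) → ∀ xs →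
                    size (encodeList enc xs) ≤ 1 + length xs * (1 + b)
size-encodeList-≤ enc enc≤ []       = ≤-refl
size-encodeList-≤ enc {b} enc≤ (x ∷ xs) = s≤s (begin
  size (enc x) + size (encodeList enc xs)   ≤⟨ +-mono-≤ (enc≤ x) (size-encodeList-≤ enc enc≤ xs) ⟩
  b + (1 + length xs * (1 + b))             ≡⟨ +-suc b _ ⟩
  1 + (b + length xs * (1 + b))             ∎)
  where open ≤-Reasoning

size-encodeBool-≤ : ∀ b → size (encodeBool b) ≤ 3
size-encodeBool-≤ false = s≤s z≤n
size-encodeBool-≤ true  = ≤-refl

encodeℕ-toℕ : ∀ b → encodeℕ (ℕᵇ.toℕ b) ≡ encodeList encodeBool (digits b)
encodeℕ-toℕ b = cong (encodeList encodeBool ∘ digits) (ℕᵇ.toℕ-injective (ℕᵇ.toℕ-fromℕ (ℕᵇ.toℕ b)))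

-- All digits of `ones k` are 1, which is encoded as `nil`. A program thus writes this number by
-- replacing each entry of a list with `nil`.
digits-ones : ∀ {A : Set} (xs : List A) →
              encodeList (λ _ → nil) xs ≡ encodeList encodeBool (digits (ones (length xs)))
digits-ones []       = refl
digits-ones (x ∷ xs) = cong (nil ∙_) (digits-ones xs)

-- Computing the graph

inputSize : Hypergraph → ℕ
inputSize = size ∘ EnumerationProblem.encode MinimalTransversalEnumeration

order-bounded : Bounded inputSize Hypergraph.order
order-bounded = bounded-≤ (λ H → begin
  Hypergraph.order H                                                      ≡⟨ length-tabulate id ⟨
  length (allFin (Hypergraph.order H))                                    ≤⟨ length-≤-size (λ _ → nil) (allFin (Hypergraph.order H)) ⟩
  size (encodeList (λ _ → nil) (allFin (Hypergraph.order H)))             ≤⟨ m≤m+n _ _ ⟩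
  size (encodeList (λ _ → nil) (allFin (Hypergraph.order H))) + size (encodeList encodeSubset (Hypergraph.hyperedges H)) ≤⟨ n≤1+n _ ⟩
  inputSize H ∎) bounded-self
  where open ≤-Reasoning

m-bounded : Bounded inputSize m
m-bounded = bounded-≤ (λ H → begin
  m H                                                       ≤⟨ length-≤-size encodeSubset (Hypergraph.hyperedges H) ⟩
  size (encodeList encodeSubset (Hypergraph.hyperedges H))  ≤⟨ m≤n+m _ _ ⟩
  size (encodeList (λ _ → nil) (allFin (Hypergraph.order H))) + size (encodeList encodeSubset (Hypergraph.hyperedges H)) ≤⟨ n≤1+n _ ⟩
  inputSize H ∎) bounded-self
  where open ≤-Reasoning

positions-bounded : Bounded inputSize (λ H → 2 + Hypergraph.order H)
positions-bounded = bounded-+ (bounded-const 2) order-bounded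

M-bounded : Bounded inputSize M
M-bounded = bounded-* m-bounded positions-bounded

N-bounded : Bounded inputSize N
N-bounded = bounded-+ (bounded-+ M-bounded M-bounded) order-bounded

isLeaf isPath isElem : ∀ {m n} → Node m n → Bool
isLeaf (leaf _ _) = true
isLeaf _          = false
isPath (path _ _) = true
isPath _          = false
isElem (elem _)   = true
isElem _          = false

-- The column of `elem v` is that of the path positions facing it, so incidence is tested by
-- equality of columns. Its row 0 is a default that the tag tests in `arc-fields` keep from
-- mattering.
row column : ∀ {m n} → Node m n → ℕ
row (leaf e p)    = toℕ e
row (path e p)    = toℕ e
row (elem v)      = 0
column (leaf e p) = toℕ p
column (path e p) = toℕ p
column (elem v)   = suc (toℕ v)

encodeKind : Kind → Tree
encodeKind k = encodeList encodeBool (digits (kindCapacity k))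

encodeTag : ∀ {m n} → Node m n → Tree
encodeTag x = encodeBool (isLeaf x) ∙ (encodeBool (isPath x) ∙ encodeBool (isElem x))

module _ (H : Hypergraph) where
  open Hypergraph H using (hyperedges) renaming (order to n)

  -- A label is the encoded capacity, except for elems. It doubles as a flag: 3 is the only path
  -- capacity with two digits, so the tail of a label is non-`nil` exactly at a `hit`.
  encodeLabel : Vertex H → Tree
  encodeLabel (leaf _ _) = nil
  encodeLabel (path e p) = encodeKind (kind H e p)
  encodeLabel (elem _)   = nil

  encodeVertex : Vertex H → Tree
  encodeVertex x = encodeTag x ∙ (unary (row x) ∙ (unary (column x) ∙ encodeLabel x))

  cells : List (Fin (m H) × Fin (2 + n))
  cells = concatMap (λ e → map (e ,_) (allFin (2 + n))) (allFin (m H))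

  leaves paths elems vertices : List (Vertex H)
  leaves   = map (uncurry leaf) cells
  paths    = map (uncurry path) cells
  elems    = map elem (allFin n)
  vertices = (leaves ++ paths) ++ elems

  tabulate-cells : ∀ {A : Set} (f : Fin (M H) → A) (g : Fin (m H) → Fin (2 + n) → A) →
    (∀ e p → f (combine e p) ≡ g e p) → tabulate f ≡ map (uncurry g) cells
  tabulate-cells f g f≗g = begin
    tabulate f
      ≡⟨ tabulate-* (m H) f ⟩
    concatMap (λ e → tabulate (λ p → f (combine e p))) (allFin (m H))
      ≡⟨ concatMap-cong (λ e → trans (tabulate-cong (f≗g e)) (sym (map-tabulate id (g e)))) (allFin (m H)) ⟩
    concatMap (λ e → map (g e) (allFin (2 + n))) (allFin (m H))
      ≡⟨ concatMap-cong (λ e → map-∘ (allFin (2 + n))) (allFin (m H)) ⟩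
    concatMap (map (uncurry g) ∘ (λ e → map (e ,_) (allFin (2 + n)))) (allFin (m H))
      ≡⟨ map-concatMap (uncurry g) (λ e → map (e ,_) (allFin (2 + n))) (allFin (m H)) ⟨
    map (uncurry g) cells ∎
    where open ≡-Reasoning

  tabulate-vertex : tabulate (vertex H) ≡ vertices
  tabulate-vertex = trans (tabulate-+ (M H + M H) (vertex H)) (cong₂ _++_
    (trans (tabulate-+ (M H) (λ i → vertex H (i ↑ˡ n))) (cong₂ _++_
      (tabulate-cells _ leaf (λ e p → vertex-number H (leaf e p)))
      (tabulate-cells _ path (λ e p → vertex-number H (path e p)))))
    (trans (tabulate-cong (λ v → vertex-number H (elem v))) (sym (map-tabulate id elem))))

  length-vertices : length vertices ≡ N H
  length-vertices = trans (cong length (sym tabulate-vertex)) (length-tabulate (vertex H))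

  length-cells : length cells ≡ M H
  length-cells = trans (sym (length-map (uncurry combine) cells))
    (trans (cong length (sym (tabulate-cells id combine λ _ _ → refl))) (length-tabulate {n = M H} id))

  length-leaves-paths : length (leaves ++ paths) ≡ M H + M H
  length-leaves-paths = trans (length-++ leaves)
    (cong₂ _+_ (trans (length-map _ cells) length-cells) (trans (length-map _ cells) length-cells))

  encodeList-vertices : ∀ (f : Vertex H → Tree) →
    encodeList f vertices ≡ encodeList (f ∘ vertex H) (allFin (N H))
  encodeList-vertices f = trans (cong (encodeList f) (sym tabulate-vertex)) (encodeList-tabulate f (vertex H))

open EnumerationProblem MinimalTransversalEnumeration using (encode)

private
  n : Hypergraph → ℕ
  n = Hypergraph.order

  allFin-bounded : ∀ {A : Set} {N f : A → ℕ} → Bounded N f → Bounded N (λ a → length (allFin (f a)))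
  allFin-bounded = bounded-≤ (λ a → ≤-reflexive (length-tabulate id))

numberingFin : ∀ {A : Set} {N l : A → ℕ} {i : A → Tree} {elt : ∀ a → Fin (l a) → Tree} → Bounded N l →
  Computes N i (λ a → encodeList (elt a) (allFin (l a))) →
  Computes N i (λ a → encodeList (λ k → unary (toℕ k) ∙ elt a k) (allFin (l a)))
numberingFin {l = l} {elt = elt} bounded list =
  outputting (λ a → trans (cong (encodeList _) (numbered-tabulate 0 id)) (encodeList-tabulate _ _))
    (numbering (λ a → allFin (l a)) (allFin-bounded bounded) list)

kindsComputed : Computes {Σ Hypergraph (Fin ∘ m)} (inputSize ∘ proj₁)
  (λ (H , e) → encodeSubset (hyperedge H e))
  (λ (H , e) → encodeList (encodeKind ∘ kind H e) (allFin (2 + n H)))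
kindsComputed = outputting (λ (H , e) →
    trans (cong (encodeKind end ∙_) (spec (hyperedge H e)))
      (trans (cong (encodeList encodeKind) (toList-lookup (kinds (hyperedge H e)))) (encodeList-tabulate encodeKind (kind H e))))
  (pair (expr (cons nil nil))
    (foldingRight (λ (H , e) → toList (hyperedge H e))
      (bounded-≤ (λ (H , e) → ≤-reflexive (length-toList (hyperedge H e))) (bounded-∘ proj₁ order-bounded))
      (λ _ b s → encodeKind (kindOf b) ∙ s)
      (expr X) (expr nil) (expr (cons (cons nil nil) nil))
      (pair (outputting (λ (_ , b , _) → spec-kind b)
              (branch (expr (hd X)) (expr (cons nil (cons nil nil))) (expr (cons (cons nil nil) nil))))
        (expr (tl (tl X))))))
  where
  spec-kind : ∀ b → select (encodeBool b) (nil ∙ (nil ∙ nil)) ((nil ∙ nil) ∙ nil) ≡ encodeKind (kindOf b)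
  spec-kind false = refl
  spec-kind true  = refl

  spec : ∀ {n} (bs : Vec Bool n) →
    foldr (λ b s → encodeKind (kindOf b) ∙ s) (encodeKind end ∙ nil) (toList bs)
    ≡ encodeList encodeKind (toList (kindsThenEnd bs))
  spec []       = refl
  spec (b ∷ bs) = cong (encodeKind (kindOf b) ∙_) (spec bs)

hyperedgesComputed : Computes inputSize encode
  (λ H → encodeList (λ e → unary (toℕ e) ∙ encodeSubset (hyperedge H e)) (allFin (m H)))
hyperedgesComputed = numberingFin m-bounded (outputting (λ H →
  trans (cong (encodeList encodeSubset) (sym (tabulate-lookup (Hypergraph.hyperedges H))))
    (encodeList-tabulate encodeSubset (hyperedge H))) (expr (tl X)))

pathsComputed : Computes inputSize encode (λ H → encodeList (encodeVertex H ∘ uncurry path) (cells H))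
pathsComputed = concatMapping (λ H → allFin (m H)) (λ H e → map (e ,_) (allFin (2 + n H)))
  (allFin-bounded m-bounded)
  (bounded-≤ (λ (H , e) → ≤-reflexive (length-map _ (allFin (2 + n H))))
    (allFin-bounded (bounded-∘ proj₁ positions-bounded)))
  hyperedgesComputed (expr nil)
  (outputting (λ (H , e) → sym (encodeList-map (encodeVertex H ∘ uncurry path) (e ,_) (allFin (2 + n H))))
    (mapping (λ (H , _) → allFin (2 + n H)) (allFin-bounded (bounded-∘ proj₁ positions-bounded))
      (numberingFin (bounded-∘ proj₁ positions-bounded) (expr (tl (hd X)) then kindsComputed))
      (expr (hd (hd X)))
      (expr (cons (cons nil (cons (cons nil nil) nil)) (cons (tl X) (cons (hd (hd X)) (tl (hd X))))))))

-- The leaves have the same rows and columns as the path vertices, so the list of paths is reused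
-- with new tags and without labels.
leavesComputed : Computes inputSize encode (λ H → encodeList (encodeVertex H ∘ uncurry leaf) (cells H))
leavesComputed = mapping cells (bounded-≤ (≤-reflexive ∘ length-cells) M-bounded)
  pathsComputed (expr nil)
  (expr (cons (cons (cons nil nil) (cons nil nil))
    (cons (hd (tl (hd X))) (cons (hd (tl (tl (hd X)))) nil))))

elemsComputed : Computes inputSize encode (λ H → encodeList (encodeVertex H ∘ elem) (allFin (n H)))
elemsComputed = mapping (allFin ∘ n) (allFin-bounded order-bounded)
  (numberingFin order-bounded (expr (hd X))) (expr nil)
  (expr (cons (cons nil (cons nil (cons nil nil))) (cons nil (cons (cons nil (hd (hd X))) nil))))

leavesAndPathsComputed : Computes inputSize encode (λ H → encodeList (encodeVertex H) (leaves H ++ paths H))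
leavesAndPathsComputed = prepending leaves
  (bounded-≤ (λ H → ≤-reflexive (trans (length-map _ (cells H)) (length-cells H))) M-bounded)
  (outputting (λ H → sym (encodeList-map (encodeVertex H) (uncurry leaf) (cells H))) leavesComputed)
  (outputting (λ H → sym (encodeList-map (encodeVertex H) (uncurry path) (cells H))) pathsComputed)

leaves-paths-bounded : Bounded inputSize (λ H → length (leaves H ++ paths H))
leaves-paths-bounded = bounded-≤ (≤-reflexive ∘ length-leaves-paths) (bounded-+ M-bounded M-bounded)

vertices-bounded : Bounded inputSize (length ∘ vertices)
vertices-bounded = bounded-≤ (≤-reflexive ∘ length-vertices) N-bounded

verticesComputed : Computes inputSize encode (λ H → encodeList (encodeVertex H) (vertices H))
verticesComputed = prepending (λ H → leaves H ++ paths H) leaves-paths-bounded leavesAndPathsComputed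
  (outputting (λ H → sym (encodeList-map (encodeVertex H) elem (allFin (n H)))) elemsComputed)

isHitPath : ∀ H → Vertex H → Bool
isHitPath H (path e p) = isHit (kind H e p)
isHitPath H _          = false

-- This expresses `arc` by the encoded fields alone, in a form that a program evaluates by
-- connectives and comparisons without distinguishing kinds of nodes.
arc-fields : ∀ H x y →
  isPath y ∧ (row x ≡ᵇ row y) ∧
    (isLeaf x ∧ (column x ≡ᵇ column y) ∨ isPath x ∧ (suc (column x) ≡ᵇ column y))
  ∨ isPath x ∧ isElem y ∧ isHitPath H x ∧ (column x ≡ᵇ column y)
  ≡ arc H x y
arc-fields H (leaf e p) (leaf f q) = refl
arc-fields H (leaf e p) (path f q) =
  trans (Bool.∨-identityʳ _) (cong ((toℕ e ≡ᵇ toℕ f) ∧_) (Bool.∨-identityʳ _))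
arc-fields H (leaf e p) (elem v)   = refl
arc-fields H (path e p) (leaf f q) = refl
arc-fields H (path e p) (path f q) = Bool.∨-identityʳ _
arc-fields H (path e p) (elem v)   = refl
arc-fields H (elem v)   (leaf f q) = refl
arc-fields H (elem v)   (path f q) = trans (Bool.∨-identityʳ _) (Bool.∧-zeroʳ _)
arc-fields H (elem v)   (elem w)   = refl

Pair : Hypergraph → Set
Pair H = Vertex H × Vertex H

row-≤ : ∀ H (x : Vertex H) → row x ≤ m H
row-≤ H (leaf e p) = <⇒≤ (Fin.toℕ<n e)
row-≤ H (path e p) = <⇒≤ (Fin.toℕ<n e)
row-≤ H (elem v)   = z≤n

column-≤ : ∀ H (x : Vertex H) → column x ≤ 2 + n H
column-≤ H (leaf e p) = <⇒≤ (Fin.toℕ<n p)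
column-≤ H (path e p) = <⇒≤ (Fin.toℕ<n p)
column-≤ H (elem v)   = ≤-trans (Fin.toℕ<n v) (m≤n+m (n H) 2)

arcComputed : Computes {Σ Hypergraph Pair} (inputSize ∘ proj₁)
  (λ (H , x , y) → encodeVertex H x ∙ encodeVertex H y) (λ (H , x , y) → encodeBool (arc H x y))
arcComputed = outputting (λ (H , x , y) → cong encodeBool (arc-fields H x y))
  (disjoining
    (conjoining (flag (path? tl) (λ (H , x , y) → isPath y) (λ _ → refl))
      (conjoining (comparing (rows (λ _ → proj₁)) (rows (λ _ → proj₂)) (expr (row? hd)) (expr (row? tl)))
        (disjoining
          (conjoining (flag (leaf? hd) (λ (H , x , y) → isLeaf x) (λ _ → refl))
            (comparing (columns (λ _ → proj₁)) (columns (λ _ → proj₂)) (expr (column? hd)) (expr (column? tl))))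
          (conjoining (flag (path? hd) (λ (H , x , y) → isPath x) (λ _ → refl))
            (comparing (bounded-+ (bounded-const 1) (columns (λ _ → proj₁))) (columns (λ _ → proj₂))
              (expr (cons nil (column? hd))) (expr (column? tl)))))))
    (conjoining (flag (path? hd) (λ (H , x , y) → isPath x) (λ _ → refl))
      (conjoining (flag (elem? tl) (λ (H , x , y) → isElem y) (λ _ → refl))
        (conjoining
          (outputting (λ (H , x , y) → spec H x) (expr (tl (tl (tl (tl (hd X)))))))
          (comparing (columns (λ _ → proj₁)) (columns (λ _ → proj₂)) (expr (column? hd)) (expr (column? tl)))))))
  where
  leaf? path? elem? row? column? : (Expr → Expr) → Expr
  leaf? which   = hd (hd (which X))
  path? which   = hd (tl (hd (which X)))
  elem? which   = tl (tl (hd (which X)))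
  row? which    = hd (tl (which X))
  column? which = hd (tl (tl (which X)))

  i : Σ Hypergraph Pair → Tree
  i (H , x , y) = encodeVertex H x ∙ encodeVertex H y

  flag : ∀ e (b : Σ Hypergraph Pair → Bool) → (∀ a → eval e (i a) ≡ encodeBool (b a)) →
    Computes (inputSize ∘ proj₁) i (encodeBool ∘ b)
  flag e b eq = outputting eq (expr e)

  rows : (f : ∀ H → Pair H → Vertex H) → Bounded (inputSize ∘ proj₁) (λ (H , xy) → row (f H xy))
  rows f = bounded-≤ (λ (H , xy) → row-≤ H (f H xy)) (bounded-∘ proj₁ m-bounded)

  columns : (f : ∀ H → Pair H → Vertex H) → Bounded (inputSize ∘ proj₁) (λ (H , xy) → column (f H xy))
  columns f = bounded-≤ (λ (H , xy) → column-≤ H (f H xy)) (bounded-∘ proj₁ positions-bounded)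

  spec : ∀ H (x : Vertex H) → tail (encodeLabel H x) ≡ encodeBool (isHitPath H x)
  spec H (leaf e p) = refl
  spec H (elem v)   = refl
  spec H (path e p) with kind H e p
  ... | end  = refl
  ... | miss = refl
  ... | hit  = refl

adjComputed : Computes {Σ Hypergraph Pair} (inputSize ∘ proj₁)
  (λ (H , x , y) → encodeVertex H x ∙ encodeVertex H y) (λ (H , x , y) → encodeBool (adj H x y))
adjComputed = disjoining arcComputed
  (expr (cons (tl X) (hd X)) then reindexed (λ (H , x , y) → H , y , x) arcComputed)

matrixComputed : Computes inputSize (λ H → encodeList (encodeVertex H) (vertices H))
  (λ H → encodeList (λ x → encodeList (λ y → encodeBool (adj H x y)) (vertices H)) (vertices H))
matrixComputed = mapping vertices vertices-bounded (expr X) (expr X)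
  (mapping (vertices ∘ proj₁) (bounded-∘ proj₁ vertices-bounded) (expr (tl X)) (expr (hd X))
    (expr (cons (tl X) (hd X)) then reindexed (λ ((H , x) , y) → H , x , y) adjComputed))

-- The list of vertices with every entry replaced by `nil` encodes `ones N` and is passed along as
-- the capacity of each elem. For the other vertices the label is the capacity, `nil` being the 0 of
-- a leaf.
capacitiesComputed : Computes inputSize (λ H → encodeList (encodeVertex H) (vertices H))
  (λ H → encodeList (encodeList encodeBool ∘ digits ∘ capacity H) (vertices H))
capacitiesComputed = mapping vertices vertices-bounded (expr X)
  (mapping vertices vertices-bounded {out = λ _ _ → nil} (expr X) (expr nil) (expr nil))
  (outputting (λ (H , x) → spec H x)
    (branch (expr (tl (tl (hd (hd X))))) (expr (tl X)) (expr (tl (tl (tl (hd X)))))))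
  where
  spec : ∀ H x → select (encodeBool (isElem x)) (encodeList (λ _ → nil) (vertices H)) (encodeLabel H x)
               ≡ encodeList encodeBool (digits (capacity H x))
  spec H (leaf e p) = refl
  spec H (path e p) = refl
  spec H (elem v)   = trans (digits-ones (vertices H))
    (cong (encodeList encodeBool ∘ digits ∘ ones) (length-vertices H))

-- Correctness and size of the computed graph, and the reduction

BipartiteCovers : EnumerationProblem
BipartiteCovers = MinimalCapacitatedVertexCoverEnumeration (λ G → Graph.Degenerate G 2 × Graph.Bipartite G)

reductionGraph : Hypergraph → EnumerationProblem.Instance BipartiteCovers
reductionGraph H = graph H , (degenerate H , bipartite H) , cap H ∘ vertex H

matrix-correct : ∀ H →
  encodeList (λ x → encodeList (λ y → encodeBool (adj H x y)) (vertices H)) (vertices H)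
  ≡ encodeList encodeSubset (tabulate (Graph.neighbours (graph H)))
matrix-correct H = begin
  encodeList (λ x → encodeList (λ y → encodeBool (adj H x y)) (vertices H)) (vertices H)
    ≡⟨ encodeList-vertices H _ ⟩
  encodeList (λ i → encodeList (λ y → encodeBool (adj H (vertex H i) y)) (vertices H)) (allFin (N H))
    ≡⟨ encodeList-cong (λ i → begin
         encodeList (λ y → encodeBool (adj H (vertex H i) y)) (vertices H)
           ≡⟨ encodeList-vertices H _ ⟩
         encodeList (λ j → encodeBool (adj H (vertex H i) (vertex H j))) (allFin (N H))
           ≡⟨ encodeList-tabulate encodeBool _ ⟨
         encodeList encodeBool (tabulate (λ j → adj H (vertex H i) (vertex H j)))
           ≡⟨ cong (encodeList encodeBool) (toList-tabulate _) ⟨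
         encodeSubset (Graph.neighbours (graph H) i) ∎) (allFin (N H)) ⟩
  encodeList (encodeSubset ∘ Graph.neighbours (graph H)) (allFin (N H))
    ≡⟨ encodeList-tabulate encodeSubset _ ⟨
  encodeList encodeSubset (tabulate (Graph.neighbours (graph H))) ∎
  where open ≡-Reasoning

capacities-correct : ∀ H →
  encodeList (encodeList encodeBool ∘ digits ∘ capacity H) (vertices H)
  ≡ encodeList encodeℕ (tabulate (cap H ∘ vertex H))
capacities-correct H = begin
  encodeList (encodeList encodeBool ∘ digits ∘ capacity H) (vertices H)
    ≡⟨ encodeList-vertices H _ ⟩
  encodeList (encodeList encodeBool ∘ digits ∘ capacity H ∘ vertex H) (allFin (N H))
    ≡⟨ encodeList-cong (λ i → encodeℕ-toℕ (capacity H (vertex H i))) (allFin (N H)) ⟨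
  encodeList (encodeℕ ∘ cap H ∘ vertex H) (allFin (N H))
    ≡⟨ encodeList-tabulate encodeℕ _ ⟨
  encodeList encodeℕ (tabulate (cap H ∘ vertex H)) ∎
  where open ≡-Reasoning

graphComputed : Computes inputSize (λ H → encodeList (encodeVertex H) (vertices H))
  (EnumerationProblem.encode BipartiteCovers ∘ reductionGraph)
graphComputed = pair (outputting matrix-correct matrixComputed) (outputting capacities-correct capacitiesComputed)

size-encodeSubset-≤ : ∀ {n} (S : Subset n) → size (encodeSubset S) ≤ 1 + n * 4
size-encodeSubset-≤ S = ≤-trans (size-encodeList-≤ encodeBool size-encodeBool-≤ (toList S))
  (≤-reflexive (cong (λ k → 1 + k * 4) (length-toList S)))

-- Each 4 is one pairing node and a Boolean of size at most 3. The 7 leaves room for the constant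
-- size of path capacities as well as for the `1 + N H * 4` of an elem.
graph-size : ∀ H → size (EnumerationProblem.encode BipartiteCovers (reductionGraph H)) ≤
  1 + ((1 + N H * (1 + (1 + N H * 4))) + (1 + N H * (1 + (7 + N H * 4))))
graph-size H = s≤s (+-mono-≤
  (≤-trans (size-encodeList-≤ encodeSubset size-encodeSubset-≤ (tabulate (Graph.neighbours (graph H))))
    (≤-reflexive (cong (λ k → 1 + k * (1 + (1 + N H * 4))) (length-tabulate (Graph.neighbours (graph H))))))
  (≤-trans (≤-reflexive (trans (cong size (sym (capacities-correct H))) (cong size (encodeList-vertices H _))))
    (≤-trans (size-encodeList-≤ _ (λ i → capacity-size (vertex H i)) (allFin (N H)))
      (≤-reflexive (cong (λ k → 1 + k * (1 + (7 + N H * 4))) (length-tabulate {n = N H} id))))))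
  where
  length-ones : ∀ k → length (digits (ones k)) ≡ k
  length-ones zero    = refl
  length-ones (suc k) = cong suc (length-ones k)

  capacity-size : ∀ x → size (encodeList encodeBool (digits (capacity H x))) ≤ 7 + N H * 4
  capacity-size (leaf e p) = s≤s z≤n
  capacity-size (path e p) with kind H e p
  ... | end  = ≤-trans (m≤n+m 3 4) (m≤m+n 7 _)
  ... | miss = ≤-trans (m≤n+m 5 2) (m≤m+n 7 _)
  ... | hit  = ≤-trans (m≤n+m 5 2) (m≤m+n 7 _)
  capacity-size (elem v) = ≤-trans (size-encodeList-≤ encodeBool size-encodeBool-≤ (digits (ones (N H))))
    (+-mono-≤ {1} {7} (s≤s z≤n) (≤-reflexive (cong (_* 4) (length-ones (N H)))))

-- The elems have the largest numbers, so cutting a cover down to them amounts to dropping a prefix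
-- of its bits.
dropTree-encodeSubset : ∀ H C →
  dropTree (length (leaves H ++ paths H)) (encodeSubset C) ≡ encodeSubset (restrict H C)
dropTree-encodeSubset H C = begin
  dropTree (length (leaves H ++ paths H)) (encodeSubset C)
    ≡⟨ cong₂ (λ k bs → dropTree k (encodeList encodeBool bs))
         (trans (length-leaves-paths H) (sym (length-tabulate first)))
         (trans (toList-lookup C) (tabulate-+ (M H + M H) (lookup C))) ⟩
  dropTree (length (tabulate first)) (encodeList encodeBool (tabulate first ++ tabulate second))
    ≡⟨ dropTree-++ encodeBool (tabulate first) (tabulate second) ⟩
  encodeList encodeBool (tabulate second)
    ≡⟨ cong (encodeList encodeBool) (toList-tabulate second) ⟨
  encodeSubset (restrict H C) ∎
  where
  open ≡-Reasoning
  first : Fin (M H + M H) → Bool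
  first i = lookup C (i ↑ˡ Hypergraph.order H)
  second : Fin (Hypergraph.order H) → Bool
  second j = lookup C ((M H + M H) ↑ʳ j)

reduction : Reduction MinimalTransversalEnumeration BipartiteCovers
reduction = record
  { translate      = reductionGraph
  -- A list of length `M H + M H`, to count off the bits that `decode` drops from a cover.
  ; advice         = λ H → encodeList (encodeVertex H) (leaves H ++ paths H)
  ; decode         = λ H → dropTree (length (leaves H ++ paths H))
  ; translating    = pair leavesAndPathsComputed (verticesComputed then graphComputed)
  ; decoding       = dropping (λ (H , _) → leaves H ++ paths H) (bounded-∘ proj₁ leaves-paths-bounded)
                       (expr (hd X)) (expr (tl X))
  ; size-bounded   = bounded-≤ graph-size (bounded-+ (bounded-const 1) (bounded-+
                       (bounded-+ (bounded-const 1) (bounded-* N-bounded (bounded-+ (bounded-const 1)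
                         (bounded-+ (bounded-const 1) (bounded-* N-bounded (bounded-const 4))))))
                       (bounded-+ (bounded-const 1) (bounded-* N-bounded (bounded-+ (bounded-const 1)
                         (bounded-+ (bounded-const 7) (bounded-* N-bounded (bounded-const 4))))))))
  ; output-bounded = bounded-≤ (λ (H , C) → size-encodeSubset-≤ C)
                       (bounded-∘ proj₁ (bounded-+ (bounded-const 1) (bounded-* N-bounded (bounded-const 4))))
  ; back           = restrict
  ; forth          = extend
  ; decode-encode  = dropTree-encodeSubset
  ; back-solution  = restrict-minimal
  ; forth-solution = extend-minimal
  ; back-forth     = restrict-extend
  ; forth-back     = extend-restrict
  }

theorem10 :
  let CVC = MinimalCapacitatedVertexCoverEnumeration (λ G → Graph.Degenerate G 2 × Graph.Bipartite G)
      Trans = MinimalTransversalEnumeration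
  in (OutputPolynomialTime CVC → OutputPolynomialTime Trans)
     × (PolynomialDelay CVC → PolynomialDelay Trans)
theorem10 = outputPolynomialTime reduction , polynomialDelay reduction
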